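{- Let $H$ be a graph. The class of $H$-free weakly chordal graphs has bounded clique-width if and only if $H$ is an induced subgraph of $P_4$.
   Context: All graphs are finite, simple and undirected. $G$ is $H$-free if it has no induced subgraph isomorphic to $H$. A graph $G$ is weakly chordal if neither $G$ nor its complement $\overline{G}$ contains an induced cycle $C_r$ with $r\geq 5$. $P_4$ is the path on 4 vertices. The clique-width of a graph $G$ is the minimum number $k$ of labels needed to construct $G$ using the operations: create a single vertex with label $i$; take the disjoint union of two labelled graphs; add all edges between vertices of label $i$ and vertices of label $j$ ($i\neq j$); rename label $i$ to $j$. A class of graphs has bounded clique-width if there is a constant $c$ such that every graph in the class has clique-width at most $c$. -}

module Defs where

open import Data.Nat using (ℕ; zero; suc; _≤_; _+_)
open import Data.Nat.DivMod using (_%_)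
open import Data.Bool using (Bool; true; false; _∧_; _∨_; not; if_then_else_)
open import Data.Bool.Properties using (∨-comm)
open import Data.Fin using (Fin; toℕ; splitAt; _≟_)
open import Data.Sum using (_⊎_; inj₁; inj₂)
open import Data.Product using (Σ; ∃; _×_; _,_)
open import Data.Empty using (⊥)
open import Relation.Nullary using (¬_; yes; no; Dec)
open import Relation.Nullary.Decidable using (isYes)
open import Relation.Binary.PropositionalEquality using (_≡_; _≢_; refl; sym; cong₂)
open import Function.Definitions using (Injective)

record Graph : Set where
  field
    V      : ℕ
    E      : Fin V → Fin V → Bool
    E-sym  : ∀ u v → E u v ≡ E v u
    E-irr  : ∀ v → E v v ≡ false
open Graph public

_≠ᵇ_ : ∀ {n} → Fin n → Fin n → Bool
u ≠ᵇ v = not (isYes (u ≟ v))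

private
  ≠ᵇ-sym : ∀ {n} (u v : Fin n) → (u ≠ᵇ v) ≡ (v ≠ᵇ u)
  ≠ᵇ-sym u v with u ≟ v | v ≟ u
  ... | yes _ | yes _ = refl
  ... | no _  | no _  = refl
  ... | yes p | no q  with q (sym p)
  ... | ()
  ≠ᵇ-sym u v | no p | yes q with p (sym q)
  ... | ()

  ≠ᵇ-irr : ∀ {n} (u : Fin n) → (u ≠ᵇ u) ≡ false
  ≠ᵇ-irr u with u ≟ u
  ... | yes _ = refl
  ... | no p with p refl
  ... | ()

mkGraph : (n : ℕ) → (Fin n → Fin n → Bool) → Graph
mkGraph n R = record
  { V = n
  ; E = λ u v → (u ≠ᵇ v) ∧ (R u v ∨ R v u)
  ; E-sym = λ u v → cong₂ _∧_ (≠ᵇ-sym u v) (∨-comm (R u v) (R v u))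
  ; E-irr = λ u → cong₂ _∧_ (≠ᵇ-irr u) refl
  }

complement : Graph → Graph
complement G = mkGraph (V G) (λ u v → not (E G u v))

_==_ : ℕ → ℕ → Bool
m == n = isYes (m Data.Nat.≟ n)

-- The cycle C_r on Fin r: i adjacent to i+1 (mod r). (A cycle for r ≥ 3.)
Cycle : ℕ → Graph
Cycle r = mkGraph r (λ u v → (suc (toℕ u) % suc r') == toℕ v)
  where
  r' : ℕ
  r' = Data.Nat.pred r

P4 : Graph
P4 = mkGraph 4 (λ u v → suc (toℕ u) == toℕ v)

_⊑_ : Graph → Graph → Set
H ⊑ G = Σ (Fin (V H) → Fin (V G)) λ f →
          Injective _≡_ _≡_ f × (∀ u v → E H u v ≡ E G (f u) (f v))

Free : Graph → Graph → Set
Free H G = ¬ (H ⊑ G)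

WeaklyChordal : Graph → Set
WeaklyChordal G = ∀ r → 5 ≤ r → ¬ (Cycle r ⊑ G) × ¬ (Cycle r ⊑ complement G)

data CWExpr (k : ℕ) : ℕ → Set where
  empty  : CWExpr k 0     -- only used for the null graph
  vertex : Fin k → CWExpr k 1
  union  : ∀ {m n} → CWExpr k m → CWExpr k n → CWExpr k (m + n)
  join   : ∀ {n} (i j : Fin k) → i ≢ j → CWExpr k n → CWExpr k n
  rename : ∀ {n} (i j : Fin k) → CWExpr k n → CWExpr k n

label : ∀ {k n} → CWExpr k n → Fin n → Fin k
label empty ()
label (vertex i) _ = i
label (union {m} e f) x with splitAt m x
... | inj₁ a = label e a
... | inj₂ b = label f b
label (join i j _ e) x = label e x
label (rename i j e) x with label e x ≟ i
... | yes _ = j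
... | no _  = label e x

adj : ∀ {k n} → CWExpr k n → Fin n → Fin n → Bool
adj empty () _
adj (vertex i) _ _ = false
adj (union {m} e f) x y with splitAt m x | splitAt m y
... | inj₁ a | inj₁ b = adj e a b
... | inj₂ a | inj₂ b = adj f a b
... | inj₁ _ | inj₂ _ = false
... | inj₂ _ | inj₁ _ = false
adj (join i j _ e) x y =
  adj e x y ∨ ((isYes (label e x ≟ i) ∧ isYes (label e y ≟ j))
             ∨ (isYes (label e x ≟ j) ∧ isYes (label e y ≟ i)))
adj (rename i j e) x y = adj e x y

-- G has clique-width at most k: some k-expression builds a graph isomorphic
-- to G (vertex bijection f, given as an injective self-map of Fin (V G)).
CWAtMost : ℕ → Graph → Set
CWAtMost k G = Σ (CWExpr k (V G)) λ e → Σ (Fin (V G) → Fin (V G)) λ f →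
                 Injective _≡_ _≡_ f × (∀ u v → E G u v ≡ adj e (f u) (f v))

BoundedCW : (Graph → Set) → Set
BoundedCW 𝒞 = ∃ λ c → ∀ G → 𝒞 G → CWAtMost c G

{-# OPTIONS --safe #-}
module Submission where

-- Forward direction. Let B be the incidence graph of the points of a line of length n and its
-- intervals. In a k-expression for B, some subexpression contains a balanced share of the points,
-- so there are k + 1 points inside and k + 1 points outside that lie on different sides of a
-- position on the line. The intervals joining them force two vertices with the same label to be
-- separated from outside the subexpression. The argument survives complementing B or making the
-- points a clique, because only vertices of the same kind are ever compared; so the bipartite
-- graph B, its complement and its split version all have unbounded clique-width, and all are
-- weakly chordal. Hence H embeds in all three. Being bipartite and co-bipartite, H has at most
-- four vertices, and the split colouring excludes 2P2 and C4; only induced subgraphs of P4 remain.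
-- Backward direction. The vertices of a P4-free graph split into two parts with either all or no
-- edges in between, so two labels suffice: glue the expressions of the parts recursively.

open import Defs
open import Algebra.Properties.CommutativeSemigroup using (interchange)
open import Data.Bool as Bool using (Bool; true; false; _∧_; _∨_; not)
open import Data.Bool.Properties using (∧-zeroʳ; ∧-conicalˡ; ∧-conicalʳ; ∨-identityʳ; ∨-idem; ¬-not; not-¬; not-involutive; not-injective)
open import Data.Empty using (⊥; ⊥-elim)
open import Data.Fin using (Fin; zero; suc; toℕ; fromℕ; splitAt; _↑ˡ_; _↑ʳ_; combine; remQuot) renaming (_<_ to _<ᶠ_; _≤_ to _≤ᶠ_; _≤?_ to _≤ᶠ?_; join to unsplit)
open import Data.Fin.Patterns using (0F; 1F; 2F; 3F; 4F)
open import Data.Fin.Properties using (_≟_; any?; all?; pigeonhole; <-cmp; suc-injective; toℕ<n; ≤fromℕ; toℕ-injective; toℕ-fromℕ<; toℕ-↑ˡ; toℕ-↑ʳ; ↑ˡ-injective; splitAt-join; splitAt-↑ˡ; splitAt-↑ʳ; splitAt⁻¹-↑ˡ; splitAt⁻¹-↑ʳ; remQuot-combine)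
open import Data.Maybe using (Maybe; just; nothing; is-just; maybe′; _>>=_)
open import Data.Maybe.Properties using (just-injective)
open import Data.Nat as ℕ using (ℕ; zero; suc; _+_; _*_; _∸_; _≤_; _<_; z≤n; s≤s; s≤s⁻¹)
open import Data.Nat.DivMod using (_%_; _mod_; m%n<n; m%n%n≡m%n; m<n⇒m%n≡m; n%n≡0; [m+n]%n≡m%n; %-distribˡ-+)
open import Data.Nat.Induction using (<-wellFounded)
open import Data.Nat.Properties using (_≤?_; ≤-refl; ≤-reflexive; ≤-trans; ≤-total; ≤-<-trans; <-≤-trans; <-trans; <⇒≤; <⇒≱; ≰⇒>; ≰⇒≥; ≮⇒≥; n≤1+n; n<1+n; m≤m+n; m≤n+m; m<m+n; m<n+m; m+[n∸m]≡n; +-suc; +-comm; +-assoc; +-commutativeSemigroup; +-cancelˡ-≤; +-mono-≤; +-monoˡ-≤; +-monoʳ-≤; +-monoʳ-<)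
open import Data.Product using (Σ; ∃; _×_; _,_; proj₁; proj₂)
open import Data.Sum as Sum using (_⊎_; inj₁; inj₂; [_,_]′)
open import Data.Sum.Properties using (inj₁-injective; inj₂-injective)
open import Data.Vec.Functional using (_∷_)
open import Function.Base using (_∘_; id; const)
open import Function.Bundles using (_⇔_; mk⇔)
open import Function.Definitions using (Injective)
open import Induction.WellFounded using (Acc; acc)
open import Relation.Binary.Definitions using (Tri; tri<; tri≈; tri>)
open import Relation.Binary.PropositionalEquality using (_≡_; _≢_; _≗_; refl; sym; trans; cong; cong₂; subst; subst₂; ≢-sym)
open import Relation.Nullary using (¬_; yes; no; Dec; does; map′; ¬?; _×-dec_; _→-dec_; contradiction)
open import Relation.Nullary.Decidable using (isYes; isYes≗does; dec-true; dec-false; decidable-stable)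

-- P4-free graphs

Adjacency : ℕ → Set
Adjacency n = Fin n → Fin n → Bool

record Cograph {n} (E : Adjacency n) : Set where
  field
    symmetric   : ∀ u v → E u v ≡ E v u
    irreflexive : ∀ v → E v v ≡ false
    no-P4       : ∀ a b c d → E a b ≡ true → E b c ≡ true → E c d ≡ true →
                  E a c ≡ false → E b d ≡ false → E a d ≡ false → ⊥

open Cograph

restrict : ∀ {m n} {E : Adjacency n} → Cograph E → (g : Fin m → Fin n) → Cograph (λ u v → E (g u) (g v))
restrict C g = record
  { symmetric   = λ u v → symmetric C (g u) (g v)
  ; irreflexive = λ v → irreflexive C (g v)
  ; no-P4       = λ a b c d → no-P4 C (g a) (g b) (g c) (g d)
  }

-- P4 is self-complementary: the complement of the path a b c d is the path c a d b.
no-P4-or-complement : ∀ {n} {E : Adjacency n} → Cograph E → ∀ β a b c d →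
  E a b ≡ not β → E b c ≡ not β → E c d ≡ not β → E a c ≡ β → E b d ≡ β → E a d ≡ β → ⊥
no-P4-or-complement C false = no-P4 C
no-P4-or-complement C true a b c d ab bc cd ac bd ad =
  no-P4 C c a d b (trans (symmetric C c a) ac) ad (trans (symmetric C d b) bd)
    cd ab (trans (symmetric C c b) bc)

-- A disjoint union when `value` is false and a complete join when it is true; keeping the Boolean
-- as a parameter settles both cases by one argument.
record Split {n} (E : Adjacency n) : Set₁ where
  field
    Side      : Fin n → Set
    side?     : ∀ u → Dec (Side u)
    inhabited : ∃ Side
    proper    : ∃ (¬_ ∘ Side)
    value     : Bool
    uniform   : ∀ u v → Side u → ¬ Side v → E u v ≡ value

open Split

flip : ∀ {n} {E : Adjacency n} → Cograph E → Split E → Split E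
flip C S = record
  { Side      = ¬_ ∘ Side S
  ; side?     = ¬? ∘ side? S
  ; inhabited = proper S
  ; proper    = proj₁ (inhabited S) , λ ¬s → ¬s (proj₂ (inhabited S))
  ; value     = value S
  ; uniform   = λ u v ¬u ¬¬v → trans (symmetric C u v) (uniform S v u (decidable-stable (side? S v) ¬¬v) ¬u)
  }
  
module _ {n} {E : Adjacency (suc n)} (C : Cograph E) (S : Split (λ u v → E (suc u) (suc v))) where

  private
    β = value S

  -- The side shrinks to its vertices `u` that see the new vertex with value `β`. Were such a `u`
  -- not uniform to a discarded `w`, then `u`, `w`, the new vertex and `z` would induce a P4 or its
  -- complement.
  extend-mixed : ∀ y z → Side S y → E zero (suc y) ≡ β → ¬ Side S z → E zero (suc z) ≡ not β → Split E
  extend-mixed y z y∈ vy z∉ vz = record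
    { Side      = Side′
    ; side?     = λ { zero → no λ () ; (suc u) → side? S u ×-dec (E zero (suc u) Bool.≟ β) }
    ; inhabited = suc y , y∈ , vy
    ; proper    = zero , λ ()
    ; value     = β
    ; uniform   = uniform′
    }
    where
    Side′ : Fin (suc n) → Set
    Side′ zero    = ⊥
    Side′ (suc u) = Side S u × E zero (suc u) ≡ β

    uniform′ : ∀ u v → Side′ u → ¬ Side′ v → E u v ≡ β
    uniform′ (suc u) zero    (_  , vu) _  = trans (symmetric C (suc u) zero) vu
    uniform′ (suc u) (suc w) (u∈ , vu) ¬w with side? S w | E (suc u) (suc w) Bool.≟ β
    ... | no w∉  | _      = uniform S u w u∈ w∉
    ... | yes _  | yes uw = uw
    ... | yes w∈ | no ¬uw = ⊥-elim (no-P4-or-complement C β (suc u) (suc w) zero (suc z)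
            (¬-not ¬uw)
            (trans (symmetric C (suc w) zero) (¬-not λ vw → ¬w (w∈ , vw)))
            vz
            (trans (symmetric C (suc u) zero) vu)
            (uniform S w z w∈ z∉)
            (uniform S u z u∈ z∉))

  extend-outside : (∀ z → ¬ Side S z → E zero (suc z) ≡ β) → Split E
  extend-outside vz = record
    { Side      = Side′
    ; side?     = λ { zero → yes (λ ()) ; (suc u) → side? S u }
    ; inhabited = suc (proj₁ (inhabited S)) , proj₂ (inhabited S)
    ; proper    = suc (proj₁ (proper S)) , proj₂ (proper S)
    ; value     = β
    ; uniform   = λ { zero zero _ ¬⊤ → ⊥-elim (¬⊤ (λ ()))
                    ; zero (suc z) _ z∉ → vz z z∉
                    ; (suc u) zero _ ¬⊤ → ⊥-elim (¬⊤ (λ ()))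
                    ; (suc u) (suc z) → uniform S u z }
    }
    where
    Side′ : Fin (suc n) → Set
    Side′ zero    = ¬ ⊥
    Side′ (suc u) = Side S u

  extend-dominating : ∀ β′ → (∀ u → E zero (suc u) ≡ β′) → Split E
  extend-dominating β′ vu = record
    { Side      = _≡ zero
    ; side?     = _≟ zero
    ; inhabited = zero , refl
    ; proper    = suc (proj₁ (inhabited S)) , λ ()
    ; value     = β′
    ; uniform   = λ { _ zero refl ¬z → ⊥-elim (¬z refl) ; _ (suc w) refl _ → vu w }
    }

  extend-from-side : ∀ y → Side S y → E zero (suc y) ≡ β → Split E
  extend-from-side y y∈ vy with any? (λ z → ¬? (side? S z) ×-dec (E zero (suc z) Bool.≟ not β))
  ... | yes (z , z∉ , vz) = extend-mixed y z y∈ vy z∉ vz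
  ... | no ∄z = extend-outside λ z z∉ → decidable-stable (_ Bool.≟ β) λ ¬vz → ∄z (z , z∉ , ¬-not ¬vz)

-- A new vertex that never takes the value of the old split is split off alone. Otherwise some `y`
-- takes it, and `y` may be assumed to lie in the side, since the two sides can be exchanged.
extend : ∀ {n} {E : Adjacency (suc n)} → Cograph E → Split (λ u v → E (suc u) (suc v)) → Split E
extend {E = E} C S with any? (λ y → E zero (suc y) Bool.≟ value S)
... | no ∄y = extend-dominating C S (not (value S)) λ u → ¬-not λ vu → ∄y (u , vu)
... | yes (y , vy) with side? S y
...   | yes y∈ = extend-from-side C S y y∈ vy
...   | no  y∉ = extend-from-side C (flip (restrict C suc) S) y y∉ vy

-- The classical fact that a P4-free graph on at least two vertices is disconnected or has a
-- disconnected complement, obtained by adding vertices one at a time.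
split : ∀ n {E : Adjacency (2 + n)} → Cograph E → Split E
split zero {E} C = record
  { Side      = _≡ 0F
  ; side?     = _≟ 0F
  ; inhabited = 0F , refl
  ; proper    = 1F , λ ()
  ; value     = E 0F 1F
  ; uniform   = λ { _ 0F refl ¬z → ⊥-elim (¬z refl) ; _ 1F refl _ → refl }
  }
split (suc n) C = extend C (split n (restrict C suc))

-- Two-label expressions from splits

record Partition {n} (P : Fin n → Set) : Set where
  field
    {m₁ m₂} : ℕ
    size    : m₁ + m₂ ≡ n
    g₁      : Fin m₁ → Fin n
    g₂      : Fin m₂ → Fin n
    g₁∈     : ∀ i → P (g₁ i)
    g₂∉     : ∀ j → ¬ P (g₂ j)
    locate  : Fin n → Fin m₁ ⊎ Fin m₂
    -- This makes `locate` injective, as the vertex numbering of the glued expression requires.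
    locate⁻ : ∀ u → [ g₁ , g₂ ]′ (locate u) ≡ u

partition : ∀ {n} {P : Fin n → Set} → (∀ u → Dec (P u)) → Partition P
partition {zero} P? = record
  { m₁ = 0 ; m₂ = 0 ; size = refl ; g₁ = λ () ; g₂ = λ () ; g₁∈ = λ () ; g₂∉ = λ () ; locate = λ () ; locate⁻ = λ () }
partition {suc n} {P} P? with P? zero | partition (P? ∘ suc)
... | yes p | Q = record
  { size    = cong suc size
  ; g₁      = λ { zero → zero ; (suc i) → suc (g₁ i) }
  ; g₂      = suc ∘ g₂
  ; g₁∈     = λ { zero → p ; (suc i) → g₁∈ i }
  ; g₂∉     = g₂∉
  ; locate  = λ { zero → inj₁ zero ; (suc u) → Sum.map₁ suc (locate u) }
  ; locate⁻ = λ { zero → refl ; (suc u) → shift u }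
  }
  where
  open Partition Q
  shift : ∀ u → [ _ , _ ]′ (Sum.map₁ suc (locate u)) ≡ suc u
  shift u with locate u | locate⁻ u
  ... | inj₁ _ | eq = cong suc eq
  ... | inj₂ _ | eq = cong suc eq
... | no ¬p | Q = record
  { size    = trans (+-suc m₁ m₂) (cong suc size)
  ; g₁      = suc ∘ g₁
  ; g₂      = λ { zero → zero ; (suc i) → suc (g₂ i) }
  ; g₁∈     = g₁∈
  ; g₂∉     = λ { zero → ¬p ; (suc i) → g₂∉ i }
  ; locate  = λ { zero → inj₂ zero ; (suc u) → Sum.map₂ suc (locate u) }
  ; locate⁻ = λ { zero → refl ; (suc u) → shift u }
  }
  where
  open Partition Q
  shift : ∀ u → [ _ , _ ]′ (Sum.map₂ suc (locate u)) ≡ suc u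
  shift u with locate u | locate⁻ u
  ... | inj₁ _ | eq = cong suc eq
  ... | inj₂ _ | eq = cong suc eq

-- The invariant `one-label` keeps the second label free: `glue` uses it to tell the two parts apart
-- during the join and then merges it back.
record Realisation {n} (E : Adjacency n) : Set where
  field
    expr      : CWExpr 2 n
    one-label : ∀ x → label expr x ≡ 0F
    position  : Fin n → Fin n
    injective : Injective _≡_ _≡_ position
    realises  : ∀ u v → E u v ≡ adj expr (position u) (position v)

open Realisation

join-if : ∀ {n} → Bool → CWExpr 2 n → CWExpr 2 n
join-if true  e = join 0F 1F (λ ()) e
join-if false e = e

glue : ∀ {m n} → Bool → CWExpr 2 m → CWExpr 2 n → CWExpr 2 (m + n)
glue β e₁ e₂ = rename 1F 0F (join-if β (union e₁ (rename 0F 1F e₂)))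

label-rename-10 : ∀ {n} (e : CWExpr 2 n) x → label (rename 1F 0F e) x ≡ 0F
label-rename-10 e x with label e x ≟ 1F
... | yes _ = refl
... | no ≢1 = ≢1⇒≡0 (label e x) ≢1
  where
  ≢1⇒≡0 : ∀ (i : Fin 2) → i ≢ 1F → i ≡ 0F
  ≢1⇒≡0 0F _  = refl
  ≢1⇒≡0 1F ≢1 = ⊥-elim (≢1 refl)

label-rename-01 : ∀ {n} (e : CWExpr 2 n) x → label e x ≡ 0F → label (rename 0F 1F e) x ≡ 1F
label-rename-01 e x ≡0 with label e x ≟ 0F
... | yes _ = refl
... | no ≢0 = ⊥-elim (≢0 ≡0)

blocks : ∀ {m n} → Bool → Adjacency m → Adjacency n → Fin m ⊎ Fin n → Fin m ⊎ Fin n → Bool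
blocks β E₁ E₂ (inj₁ a) (inj₁ b) = E₁ a b
blocks β E₁ E₂ (inj₂ a) (inj₂ b) = E₂ a b
blocks β E₁ E₂ (inj₁ _) (inj₂ _) = β
blocks β E₁ E₂ (inj₂ _) (inj₁ _) = β

adj-glue : ∀ {m n} β (e₁ : CWExpr 2 m) (e₂ : CWExpr 2 n) →
  (∀ x → label e₁ x ≡ 0F) → (∀ x → label e₂ x ≡ 0F) →
  ∀ x y → adj (glue β e₁ e₂) x y ≡ blocks β (adj e₁) (adj e₂) (splitAt m x) (splitAt m y)
adj-glue {m} false e₁ e₂ l₁ l₂ x y with splitAt m x | splitAt m y
... | inj₁ a | inj₁ b = refl
... | inj₁ a | inj₂ b = refl
... | inj₂ a | inj₁ b = refl
... | inj₂ a | inj₂ b = refl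
adj-glue {m} true e₁ e₂ l₁ l₂ x y with splitAt m x | splitAt m y
... | inj₁ a | inj₁ b rewrite l₁ a | l₁ b = ∨-identityʳ _
... | inj₁ a | inj₂ b rewrite l₁ a | label-rename-01 e₂ b (l₂ b) = refl
... | inj₂ a | inj₁ b rewrite l₁ b | label-rename-01 e₂ a (l₂ a) = refl
... | inj₂ a | inj₂ b rewrite label-rename-01 e₂ a (l₂ a) | label-rename-01 e₂ b (l₂ b) = ∨-identityʳ _

map-injective : ∀ {A B C D : Set} {f : A → C} {g : B → D} →
  Injective _≡_ _≡_ f → Injective _≡_ _≡_ g → Injective _≡_ _≡_ (Sum.map f g)
map-injective f-inj g-inj {inj₁ _} {inj₁ _} eq = cong inj₁ (f-inj (inj₁-injective eq))
map-injective f-inj g-inj {inj₂ _} {inj₂ _} eq = cong inj₂ (g-inj (inj₂-injective eq))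

realise-split : ∀ {n} {E : Adjacency n} → Cograph E → Split E →
  (∀ {m} → m < n → (g : Fin m → Fin n) → Realisation (λ u v → E (g u) (g v))) → Realisation E
realise-split {E = E} C S realise′ with partition (side? S)
-- Matching `size` with `refl` turns the vertex count into `m₁ + m₂`, the index of a union.
... | record { m₁ = m₁ ; m₂ = m₂ ; size = refl ; g₁ = g₁ ; g₂ = g₂ ; g₁∈ = g₁∈ ; g₂∉ = g₂∉
             ; locate = locate ; locate⁻ = locate⁻ } = record
  { expr      = glue β (expr R₁) (expr R₂)
  ; one-label = label-rename-10 (join-if β (union (expr R₁) (rename 0F 1F (expr R₂))))
  ; position  = unsplit m₁ m₂ ∘ positions ∘ locate
  ; injective = λ {u} {v} eq → locate-injective u v
      (map-injective (injective R₁) (injective R₂)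
        (trans (sym (splitAt-join m₁ m₂ (positions (locate u))))
          (trans (cong (splitAt m₁) eq) (splitAt-join m₁ m₂ (positions (locate v))))))
  ; realises  = λ u v → trans (realises′ u v) (sym
      (trans (adj-glue β (expr R₁) (expr R₂) (one-label R₁) (one-label R₂) _ _)
        (cong₂′ (splitAt-join m₁ m₂ (positions (locate u))) (splitAt-join m₁ m₂ (positions (locate v))))))
  }
  where
  β = value S

  fin<m+n : ∀ {m n} → Fin n → m < m + n
  fin<m+n {m} {suc n} _ = m<m+n m (s≤s z≤n)

  fin<n+m : ∀ {m n} → Fin n → m < n + m
  fin<n+m {m} {suc n} _ = m<n+m m (s≤s z≤n)

  -- The vertex outside the side must be located in the second part, which is therefore non-empty.
  m₁<n : m₁ < m₁ + m₂
  m₁<n with locate (proj₁ (proper S)) | locate⁻ (proj₁ (proper S))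
  ... | inj₁ i | eq = ⊥-elim (proj₂ (proper S) (subst (Side S) eq (g₁∈ i)))
  ... | inj₂ j | _  = fin<m+n j

  m₂<n : m₂ < m₁ + m₂
  m₂<n with locate (proj₁ (inhabited S)) | locate⁻ (proj₁ (inhabited S))
  ... | inj₁ i | _  = fin<n+m i
  ... | inj₂ j | eq = ⊥-elim (g₂∉ j (subst (Side S) (sym eq) (proj₂ (inhabited S))))

  R₁ : Realisation (λ u v → E (g₁ u) (g₁ v))
  R₁ = realise′ m₁<n g₁

  R₂ : Realisation (λ u v → E (g₂ u) (g₂ v))
  R₂ = realise′ m₂<n g₂

  positions : Fin m₁ ⊎ Fin m₂ → Fin m₁ ⊎ Fin m₂
  positions = Sum.map (position R₁) (position R₂)

  cong₂′ : ∀ {s s′ t t′} → s ≡ s′ → t ≡ t′ →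
    blocks β (adj (expr R₁)) (adj (expr R₂)) s t ≡ blocks β (adj (expr R₁)) (adj (expr R₂)) s′ t′
  cong₂′ refl refl = refl

  locate-injective : ∀ u v → locate u ≡ locate v → u ≡ v
  locate-injective u v eq = trans (sym (locate⁻ u)) (trans (cong [ g₁ , g₂ ]′ eq) (locate⁻ v))

  blocks-realise : ∀ s t → E ([ g₁ , g₂ ]′ s) ([ g₁ , g₂ ]′ t)
    ≡ blocks β (adj (expr R₁)) (adj (expr R₂)) (positions s) (positions t)
  blocks-realise (inj₁ a) (inj₁ b) = realises R₁ a b
  blocks-realise (inj₂ a) (inj₂ b) = realises R₂ a b
  blocks-realise (inj₁ a) (inj₂ b) = uniform S (g₁ a) (g₂ b) (g₁∈ a) (g₂∉ b)
  blocks-realise (inj₂ a) (inj₁ b) =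
    trans (symmetric C (g₂ a) (g₁ b)) (uniform S (g₁ b) (g₂ a) (g₁∈ b) (g₂∉ a))

  realises′ : ∀ u v → E u v
    ≡ blocks β (adj (expr R₁)) (adj (expr R₂)) (positions (locate u)) (positions (locate v))
  realises′ u v with blocks-realise (locate u) (locate v)
  ... | eq rewrite locate⁻ u | locate⁻ v = eq

realise : ∀ {n} → Acc _<_ n → {E : Adjacency n} → Cograph E → Realisation E
realise {zero} _ C = record
  { expr = empty ; one-label = λ () ; position = id ; injective = id ; realises = λ () }
realise {suc zero} _ C = record
  { expr      = vertex 0F
  ; one-label = λ _ → refl
  ; position  = id
  ; injective = id
  ; realises  = λ { 0F 0F → irreflexive C 0F }
  }
realise {suc (suc n)} (acc rs) C =
  realise-split C (split n C) λ m<n g → realise (rs m<n) (restrict C g)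

P4-embedding : ∀ G a b c d → E G a b ≡ true → E G b c ≡ true → E G c d ≡ true →
  E G a c ≡ false → E G b d ≡ false → E G a d ≡ false → P4 ⊑ G
P4-embedding G a b c d ab bc cd ac bd ad = f , (λ {u} {v} → f-injective u v) , preserves
  where
  f : Fin 4 → Fin (V G)
  f 0F = a
  f 1F = b
  f 2F = c
  f 3F = d

  rev : ∀ {u v x} → E G u v ≡ x → E G v u ≡ x
  rev {u} {v} = trans (E-sym G v u)

  preserves : ∀ u v → E P4 u v ≡ E G (f u) (f v)
  preserves 0F 0F = sym (E-irr G a)
  preserves 0F 1F = sym ab
  preserves 0F 2F = sym ac
  preserves 0F 3F = sym ad
  preserves 1F 0F = sym (rev ab)
  preserves 1F 1F = sym (E-irr G b)
  preserves 1F 2F = sym bc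
  preserves 1F 3F = sym bd
  preserves 2F 0F = sym (rev ac)
  preserves 2F 1F = sym (rev bc)
  preserves 2F 2F = sym (E-irr G c)
  preserves 2F 3F = sym cd
  preserves 3F 0F = sym (rev ad)
  preserves 3F 1F = sym (rev bd)
  preserves 3F 2F = sym (rev cd)
  preserves 3F 3F = sym (E-irr G d)

  -- Each refuted case names a vertex adjacent to exactly one of the two. Consequently a map from P4
  -- that preserves edges and non-edges is injective.
  twin-free : ∀ u v → (∀ w → E P4 u w ≡ E P4 v w) → u ≡ v
  twin-free 0F 0F _ = refl
  twin-free 0F 1F h = contradiction (h 0F) λ ()
  twin-free 0F 2F h = contradiction (h 3F) λ ()
  twin-free 0F 3F h = contradiction (h 1F) λ ()
  twin-free 1F 0F h = contradiction (h 0F) λ ()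
  twin-free 1F 1F _ = refl
  twin-free 1F 2F h = contradiction (h 0F) λ ()
  twin-free 1F 3F h = contradiction (h 0F) λ ()
  twin-free 2F 0F h = contradiction (h 3F) λ ()
  twin-free 2F 1F h = contradiction (h 0F) λ ()
  twin-free 2F 2F _ = refl
  twin-free 2F 3F h = contradiction (h 1F) λ ()
  twin-free 3F 0F h = contradiction (h 1F) λ ()
  twin-free 3F 1F h = contradiction (h 0F) λ ()
  twin-free 3F 2F h = contradiction (h 1F) λ ()
  twin-free 3F 3F _ = refl

  f-injective : ∀ u v → f u ≡ f v → u ≡ v
  f-injective u v eq = twin-free u v λ w →
    trans (preserves u w) (trans (cong (λ x → E G x (f w)) eq) (sym (preserves v w)))

P4-free⇒CWAtMost-2 : ∀ G → Free P4 G → CWAtMost 2 G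
P4-free⇒CWAtMost-2 G free = expr R , position R , injective R , realises R
  where
  R : Realisation (E G)
  R = realise (<-wellFounded (V G)) record
    { symmetric   = E-sym G
    ; irreflexive = E-irr G
    ; no-P4       = λ a b c d ab bc cd ac bd ad → free (P4-embedding G a b c d ab bc cd ac bd ad)
    }

-- Subexpressions of clique-width expressions

bit : Bool → ℕ
bit true  = 1
bit false = 0

count : ∀ {n} → (Fin n → Bool) → ℕ
count {zero}  Q = 0
count {suc n} Q = bit (Q zero) + count (Q ∘ suc)

count-cong : ∀ {n} {P Q : Fin n → Bool} → P ≗ Q → count P ≡ count Q
count-cong {zero}  P≗Q = refl
count-cong {suc n} P≗Q = cong₂ _+_ (cong bit (P≗Q zero)) (count-cong (P≗Q ∘ suc))

count-+ : ∀ {n} {P Q R : Fin n → Bool} → (∀ i → bit (P i) ≡ bit (Q i) + bit (R i)) →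
  count P ≡ count Q + count R
count-+ {zero} eq = refl
count-+ {suc n} {P} {Q} {R} eq = trans (cong₂ _+_ (eq zero) (count-+ (eq ∘ suc)))
  (interchange +-commutativeSemigroup (bit (Q zero)) (bit (R zero)) (count (Q ∘ suc)) (count (R ∘ suc)))

count-true : ∀ n → count {n} (const true) ≡ n
count-true zero    = refl
count-true (suc n) = cong suc (count-true n)

count-not : ∀ {n} (Q : Fin n → Bool) → count Q + count (not ∘ Q) ≡ n
count-not {n} Q = trans (sym (count-+ (λ i → complementary (Q i)))) (count-true n)
  where
  complementary : ∀ b → 1 ≡ bit b + bit (not b)
  complementary true  = refl
  complementary false = refl

count-false : ∀ {n} (Q : Fin n → Bool) → (∀ i → Q i ≢ true) → count Q ≡ 0
count-false {zero}  Q none = refl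
count-false {suc n} Q none with Q zero in eq
... | true  = ⊥-elim (none zero eq)
... | false = count-false (Q ∘ suc) (none ∘ suc)

count-unique : ∀ {n} (Q : Fin n → Bool) → (∀ i j → Q i ≡ true → Q j ≡ true → i ≡ j) → count Q ≤ 1
count-unique {zero}  Q unique = z≤n
count-unique {suc n} Q unique with Q zero in eq
... | true  = s≤s (≤-reflexive (count-false (Q ∘ suc) λ i qi → contradiction (unique zero (suc i) eq qi) λ ()))
... | false = count-unique (Q ∘ suc) λ i j qi qj → suc-injective (unique (suc i) (suc j) qi qj)

enumerate : ∀ {n} (Q : Fin n → Bool) m → m ≤ count Q →
  Σ (Fin m → Fin n) λ g → (∀ {i j} → i <ᶠ j → g i <ᶠ g j) × (∀ i → Q (g i) ≡ true)
enumerate Q zero m≤ = (λ ()) , (λ {}) , λ ()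
enumerate {suc n} Q (suc m) m≤ with Q zero in eq
... | true with enumerate (Q ∘ suc) m (s≤s⁻¹ m≤)
...   | g , mono , g∈ = g′ , (λ {i} {j} → mono′ i j) , λ { zero → eq ; (suc i) → g∈ i }
  where
  g′ : Fin (suc m) → Fin (suc n)
  g′ zero    = zero
  g′ (suc i) = suc (g i)
  mono′ : ∀ i j → i <ᶠ j → g′ i <ᶠ g′ j
  mono′ zero    (suc j) _         = s≤s z≤n
  mono′ (suc i) (suc j) (s≤s i<j) = s≤s (mono i<j)
enumerate {suc n} Q (suc m) m≤ | false with enumerate (Q ∘ suc) (suc m) m≤
... | g , mono , g∈ = suc ∘ g , (λ i<j → s≤s (mono i<j)) , g∈

-- A set of vertices of an expression that looks like a subexpression: vertices of it
-- that carry the same label there can no longer be told apart from outside.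
record Cut {k n} (e : CWExpr k n) : Set where
  field
    X         : Fin n → Bool
    ℓ         : Fin n → Fin k
    label-cut : ∀ u v → X u ≡ true → X v ≡ true → ℓ u ≡ ℓ v → label e u ≡ label e v
    adj-cut   : ∀ u v w → X u ≡ true → X v ≡ true → X w ≡ false → ℓ u ≡ ℓ v → adj e u w ≡ adj e v w

open Cut

cut-all : ∀ {k n} (e : CWExpr k n) → Cut e
cut-all e = record
  { X = const true ; ℓ = label e ; label-cut = λ _ _ _ _ eq → eq ; adj-cut = λ _ _ _ _ _ () }

cut-rename : ∀ {k n} {i j : Fin k} {e : CWExpr k n} → Cut e → Cut (rename i j e)
cut-rename {i = i} {j} {e} C = record
  { X = X C ; ℓ = ℓ C ; label-cut = label-cut′ ; adj-cut = adj-cut C }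
  where
  label-cut′ : ∀ u v → X C u ≡ true → X C v ≡ true → ℓ C u ≡ ℓ C v → label (rename i j e) u ≡ label (rename i j e) v
  label-cut′ u v u∈ v∈ eq with label e u ≟ i | label e v ≟ i | label-cut C u v u∈ v∈ eq
  ... | yes _ | yes _ | _ = refl
  ... | no _  | no _  | q = q
  ... | yes p | no ¬p | q = ⊥-elim (¬p (trans (sym q) p))
  ... | no ¬p | yes p | q = ⊥-elim (¬p (trans q p))

-- A join sees only current labels, and `label-cut` says that these still agree on vertices which
-- shared a label inside the cut.
cut-join : ∀ {k n} {i j : Fin k} {i≢j : i ≢ j} {e : CWExpr k n} → Cut e → Cut (join i j i≢j e)
cut-join {i = i} {j} {i≢j} {e} C = record
  { X = X C ; ℓ = ℓ C ; label-cut = label-cut C ; adj-cut = adj-cut′ }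
  where
  adj-cut′ : ∀ u v w → X C u ≡ true → X C v ≡ true → X C w ≡ false → ℓ C u ≡ ℓ C v →
    adj (join i j i≢j e) u w ≡ adj (join i j i≢j e) v w
  adj-cut′ u v w u∈ v∈ w∉ eq rewrite adj-cut C u v w u∈ v∈ w∉ eq | label-cut C u v u∈ v∈ eq = refl

module _ {k m n} {e₁ : CWExpr k m} {e₂ : CWExpr k n} where

  cut-left : Cut e₁ → Cut (union e₁ e₂)
  cut-left C = record { X = X′ ; ℓ = ℓ′ ; label-cut = label-cut′ ; adj-cut = adj-cut′ }
    where
    X′ : Fin (m + n) → Bool
    X′ x = [ X C , const false ]′ (splitAt m x)
    ℓ′ : Fin (m + n) → Fin k
    -- On the vertices of `e₂`, all outside the cut, the label is a default value.
    ℓ′ x = [ ℓ C , label e₂ ]′ (splitAt m x)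
    label-cut′ : ∀ u v → X′ u ≡ true → X′ v ≡ true → ℓ′ u ≡ ℓ′ v → label (union e₁ e₂) u ≡ label (union e₁ e₂) v
    label-cut′ u v u∈ v∈ eq with splitAt m u | splitAt m v
    ... | inj₁ a | inj₁ b = label-cut C a b u∈ v∈ eq
    label-cut′ u v u∈ () eq | inj₁ a | inj₂ b
    label-cut′ u v () v∈ eq | inj₂ a | _
    adj-cut′ : ∀ u v w → X′ u ≡ true → X′ v ≡ true → X′ w ≡ false → ℓ′ u ≡ ℓ′ v →
      adj (union e₁ e₂) u w ≡ adj (union e₁ e₂) v w
    adj-cut′ u v w u∈ v∈ w∉ eq with splitAt m u | splitAt m v | splitAt m w
    ... | inj₁ a | inj₁ b | inj₁ c = adj-cut C a b c u∈ v∈ w∉ eq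
    ... | inj₁ a | inj₁ b | inj₂ c = refl
    adj-cut′ u v w u∈ () w∉ eq | inj₁ a | inj₂ b | _
    adj-cut′ u v w () v∈ w∉ eq | inj₂ a | _ | _

  cut-right : Cut e₂ → Cut (union e₁ e₂)
  cut-right C = record { X = X′ ; ℓ = ℓ′ ; label-cut = label-cut′ ; adj-cut = adj-cut′ }
    where
    X′ : Fin (m + n) → Bool
    X′ x = [ const false , X C ]′ (splitAt m x)
    ℓ′ : Fin (m + n) → Fin k
    ℓ′ x = [ label e₁ , ℓ C ]′ (splitAt m x)
    label-cut′ : ∀ u v → X′ u ≡ true → X′ v ≡ true → ℓ′ u ≡ ℓ′ v → label (union e₁ e₂) u ≡ label (union e₁ e₂) v
    label-cut′ u v u∈ v∈ eq with splitAt m u | splitAt m v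
    ... | inj₂ a | inj₂ b = label-cut C a b u∈ v∈ eq
    label-cut′ u v u∈ () eq | inj₂ a | inj₁ b
    label-cut′ u v () v∈ eq | inj₁ a | _
    adj-cut′ : ∀ u v w → X′ u ≡ true → X′ v ≡ true → X′ w ≡ false → ℓ′ u ≡ ℓ′ v →
      adj (union e₁ e₂) u w ≡ adj (union e₁ e₂) v w
    adj-cut′ u v w u∈ v∈ w∉ eq with splitAt m u | splitAt m v | splitAt m w
    ... | inj₂ a | inj₂ b | inj₂ c = adj-cut C a b c u∈ v∈ w∉ eq
    ... | inj₂ a | inj₂ b | inj₁ c = refl
    adj-cut′ u v w u∈ () w∉ eq | inj₂ a | inj₁ b | _
    adj-cut′ u v w () v∈ w∉ eq | inj₁ a | _ | _

-- The points to be balanced are followed down an expression by a partial map, undefined at the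
-- points that lie outside the current subexpression.
PartialInjective : ∀ {N n} → (Fin N → Maybe (Fin n)) → Set
PartialInjective g = ∀ p q x → g p ≡ just x → g q ≡ just x → p ≡ q

module _ {N m n} (g : Fin N → Maybe (Fin (m + n))) where

  toˡ : Fin N → Maybe (Fin m)
  toˡ p = g p >>= λ x → [ just , const nothing ]′ (splitAt m x)

  toʳ : Fin N → Maybe (Fin n)
  toʳ p = g p >>= λ x → [ const nothing , just ]′ (splitAt m x)

  toˡ-just : ∀ p x → toˡ p ≡ just x → g p ≡ just (x ↑ˡ n)
  toˡ-just p x eq with g p
  ... | just y with splitAt m y in s
  toˡ-just p x refl | just y | inj₁ .x = cong just (sym (splitAt⁻¹-↑ˡ s))

  toʳ-just : ∀ p x → toʳ p ≡ just x → g p ≡ just (m ↑ʳ x)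
  toʳ-just p x eq with g p
  ... | just y with splitAt m y in s
  toʳ-just p x refl | just y | inj₂ .x = cong just (sym (splitAt⁻¹-↑ʳ s))

  bit-split : ∀ p → bit (is-just (g p)) ≡ bit (is-just (toˡ p)) + bit (is-just (toʳ p))
  bit-split p with g p
  ... | nothing = refl
  ... | just x with splitAt m x
  ...   | inj₁ _ = refl
  ...   | inj₂ _ = refl

  maybe-toˡ : ∀ (P : Fin m → Bool) p →
    maybe′ (λ x → [ P , const false ]′ (splitAt m x)) false (g p) ≡ maybe′ P false (toˡ p)
  maybe-toˡ P p with g p
  ... | nothing = refl
  ... | just x with splitAt m x
  ...   | inj₁ _ = refl
  ...   | inj₂ _ = refl

  maybe-toʳ : ∀ (P : Fin n → Bool) p →
    maybe′ (λ x → [ const false , P ]′ (splitAt m x)) false (g p) ≡ maybe′ P false (toʳ p)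
  maybe-toʳ P p with g p
  ... | nothing = refl
  ... | just x with splitAt m x
  ...   | inj₁ _ = refl
  ...   | inj₂ _ = refl

hits : ∀ {N n} → (Fin n → Bool) → (Fin N → Maybe (Fin n)) → ℕ
hits P g = count (maybe′ P false ∘ g)

-- Descend from the root while more than `t + t` points remain. At a union one operand keeps at
-- least `t` of them, so the first subexpression with at most `t + t` points still has `t`.
balanced-cut : ∀ {k N n t} (e : CWExpr k n) (g : Fin N → Maybe (Fin n)) → PartialInjective g →
  1 ≤ t → t ≤ count (is-just ∘ g) → Σ (Cut e) λ C → t ≤ hits (X C) g × hits (X C) g ≤ t + t
balanced-cut {N = N} {t = t} e g g-inj 1≤t t≤ with count (is-just ∘ g) ≤? t + t
... | yes small = cut-all e , subst (t ≤_) is-just-true t≤ , subst (_≤ t + t) is-just-true small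
  where
  is-just-true : count (is-just ∘ g) ≡ count (maybe′ (const true) false ∘ g)
  is-just-true = count-cong λ p → pointwise (g p)
    where
    pointwise : ∀ x → is-just x ≡ maybe′ (const true) false x
    pointwise nothing  = refl
    pointwise (just _) = refl
... | no large = descend e g g-inj large
  where
  descend : ∀ {n} (e : CWExpr _ n) (g : Fin N → Maybe (Fin n)) → PartialInjective g →
    ¬ count (is-just ∘ g) ≤ t + t → Σ (Cut e) λ C → t ≤ hits (X C) g × hits (X C) g ≤ t + t
  descend empty g g-inj large = ⊥-elim (large (subst (_≤ t + t) (sym none) z≤n))
    where
    none : count (is-just ∘ g) ≡ 0
    none = count-false (is-just ∘ g) λ i eq → void (g i) eq
      where
      void : ∀ (x : Maybe (Fin 0)) → is-just x ≢ true
      void (just ())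
      void nothing ()
  -- By injectivity a single vertex carries at most one point, and one is at most `t + t`.
  descend (vertex i) g g-inj large =
    ⊥-elim (large (≤-trans (count-unique (is-just ∘ g) unique) (≤-trans 1≤t (m≤m+n t t))))
    where
    to-zero : ∀ (x : Maybe (Fin 1)) → is-just x ≡ true → x ≡ just zero
    to-zero (just zero) _ = refl
    unique : ∀ p q → is-just (g p) ≡ true → is-just (g q) ≡ true → p ≡ q
    unique p q p∈ q∈ = g-inj p q zero (to-zero (g p) p∈) (to-zero (g q) q∈)
  descend (join i j i≢j e) g g-inj large with balanced-cut e g g-inj 1≤t (≤-trans (m≤m+n t t) (≰⇒≥ large))
  ... | C , bounds = cut-join C , bounds
  descend (rename i j e) g g-inj large with balanced-cut e g g-inj 1≤t (≤-trans (m≤m+n t t) (≰⇒≥ large))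
  ... | C , bounds = cut-rename C , bounds
  descend (union {m} {n} e₁ e₂) g g-inj large with t ≤? count (is-just ∘ toˡ g)
  ... | yes t≤ˡ with balanced-cut e₁ (toˡ g) (λ p q x p↦ q↦ → g-inj p q _ (toˡ-just g p x p↦) (toˡ-just g q x q↦)) 1≤t t≤ˡ
  ...   | C , lower , upper = cut-left C , subst (t ≤_) same lower , subst (_≤ t + t) same upper
    where
    same : hits (X C) (toˡ g) ≡ hits (X (cut-left {e₂ = e₂} C)) g
    same = count-cong λ p → sym (maybe-toˡ g (X C) p)
  descend (union {m} {n} e₁ e₂) g g-inj large | no t≰ˡ
    with balanced-cut e₂ (toʳ g) (λ p q x p↦ q↦ → g-inj p q _ (toʳ-just g p x p↦) (toʳ-just g q x q↦)) 1≤t t≤ʳ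
    where
    t≤ʳ : t ≤ count (is-just ∘ toʳ g)
    t≤ʳ = ≮⇒≥ λ r<t → large (subst (_≤ t + t) (sym (count-+ (bit-split g)))
      (+-mono-≤ (<⇒≤ (≰⇒> t≰ˡ)) (<⇒≤ r<t)))
  ... | C , lower , upper = cut-right C , subst (t ≤_) same lower , subst (_≤ t + t) same upper
    where
    same : hits (X C) (toʳ g) ≡ hits (X (cut-right {e₁ = e₁} C)) g
    same = count-cong λ p → sym (maybe-toʳ g (X C) p)

-- Points and intervals

between : ∀ {n} → Fin n → Fin n → Fin n → Bool
between a b p = does (a ≤ᶠ? p) ∧ does (p ≤ᶠ? b)

between-true : ∀ {n} (a b p : Fin n) → a ≤ᶠ p → p ≤ᶠ b → between a b p ≡ true
between-true a b p a≤p p≤b = cong₂ _∧_ (dec-true (a ≤ᶠ? p) a≤p) (dec-true (p ≤ᶠ? b) p≤b)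

between-below : ∀ {n} (a b p : Fin n) → p <ᶠ a → between a b p ≡ false
between-below a b p p<a = cong (_∧ does (p ≤ᶠ? b)) (dec-false (a ≤ᶠ? p) (<⇒≱ p<a))

between-above : ∀ {n} (a b p : Fin n) → b <ᶠ p → between a b p ≡ false
between-above a b p b<p =
  trans (cong (does (a ≤ᶠ? p) ∧_) (dec-false (p ≤ᶠ? b) (<⇒≱ b<p))) (∧-zeroʳ (does (a ≤ᶠ? p)))

differ : ∀ {x y : Bool} → x ≡ true → y ≡ false → x ≢ y
differ refl refl ()

-- Adjacency among points and among intervals is left open, so that bipartite, co-bipartite and
-- split versions are all covered; `code` becomes negation in the complement.
record PointInterval (n : ℕ) (G : Graph) : Set where
  field
    point           : Fin n → Fin (V G)
    interval        : Fin n → Fin n → Fin (V G)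
    point-injective : Injective _≡_ _≡_ point
    disjoint        : ∀ p a b → point p ≢ interval a b
    code            : Bool → Bool
    code-injective  : Injective _≡_ _≡_ code
    incidence       : ∀ p a b → E G (point p) (interval a b) ≡ code (between a b p)

open PointInterval

record Interleaved {n} (A : Fin n → Bool) (s : ℕ) : Set where
  field
    p q      : Fin s → Fin n
    p-mono   : ∀ {i j} → i <ᶠ j → p i <ᶠ p j
    q-mono   : ∀ {i j} → i <ᶠ j → q i <ᶠ q j
    p∈       : ∀ i → A (p i) ≡ true
    q∉       : ∀ j → A (q j) ≡ false
    ordered  : (∀ i j → p i <ᶠ q j) ⊎ (∀ i j → q j <ᶠ p i)

monotone : ∀ {m n} {g : Fin m → Fin n} → (∀ {i j} → i <ᶠ j → g i <ᶠ g j) → ∀ {i j} → i ≤ᶠ j → g i ≤ᶠ g j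
monotone mono {i} {j} i≤j with <-cmp i j
... | tri< i<j _ _  = <⇒≤ (mono i<j)
... | tri≈ _ refl _ = ≤-refl
... | tri> _ _ j<i  = ⊥-elim (<⇒≱ j<i i≤j)

↑ˡ-mono : ∀ {m} n {i j : Fin m} → i <ᶠ j → (i ↑ˡ n) <ᶠ (j ↑ˡ n)
↑ˡ-mono n {i} {j} = subst₂ _<_ (sym (toℕ-↑ˡ i n)) (sym (toℕ-↑ˡ j n))

↑ʳ-mono : ∀ m {n} {i j : Fin n} → i <ᶠ j → (m ↑ʳ i) <ᶠ (m ↑ʳ j)
↑ʳ-mono m {i = i} {j} i<j = subst₂ _<_ (sym (toℕ-↑ʳ m i)) (sym (toℕ-↑ʳ m j)) (+-monoʳ-< m i<j)

↑ˡ<↑ʳ : ∀ {m n} (i : Fin m) (j : Fin n) → (i ↑ˡ n) <ᶠ (m ↑ʳ j)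
↑ˡ<↑ʳ {m} {n} i j = subst₂ _<_ (sym (toℕ-↑ˡ i n)) (sym (toℕ-↑ʳ m j)) (<-≤-trans (toℕ<n i) (m≤m+n m (toℕ j)))

↑ˡ≤last : ∀ {r} n (i : Fin (suc r)) → (i ↑ˡ n) ≤ᶠ (fromℕ r ↑ˡ n)
↑ˡ≤last {r} n i = subst₂ _≤_ (sym (toℕ-↑ˡ i n)) (sym (toℕ-↑ˡ (fromℕ r) n)) (≤fromℕ i)

first≤↑ʳ : ∀ m {r} (j : Fin (suc r)) → (m ↑ʳ zero {r}) ≤ᶠ (m ↑ʳ j)
first≤↑ʳ m {r} j = subst₂ _≤_ (sym (toℕ-↑ʳ m (zero {r}))) (sym (toℕ-↑ʳ m j)) (+-monoʳ-≤ m z≤n)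

-- The lower half of whichever set has the smaller median lies before the upper half of the other.
interleave : ∀ {n} (A : Fin n → Bool) s → s + s ≤ count A → s + s ≤ count (not ∘ A) → Interleaved A s
interleave A zero _ _ = record
  { p = λ () ; q = λ () ; p-mono = λ { {()} } ; q-mono = λ { {()} }
  ; p∈ = λ () ; q∉ = λ () ; ordered = inj₁ (λ ()) }
interleave A s@(suc r) s≤ s≤′ with enumerate A (s + s) s≤ | enumerate (not ∘ A) (s + s) s≤′
... | a , a-mono , a∈ | b , b-mono , b∈ = by-medians (<-cmp (a last) (b middle))
  where
  last middle : Fin (s + s)
  last   = fromℕ r ↑ˡ s
  middle = s ↑ʳ zero

  b∉ : ∀ j → A (b j) ≡ false
  b∉ j with A (b j) | b∈ j
  ... | false | _ = refl

  by-medians : Tri (a last <ᶠ b middle) (a last ≡ b middle) (b middle <ᶠ a last) → Interleaved A s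
  by-medians (tri< a<b _ _) = record
    { p = a ∘ (_↑ˡ s) ; q = b ∘ (s ↑ʳ_)
    ; p-mono = a-mono ∘ ↑ˡ-mono s ; q-mono = b-mono ∘ ↑ʳ-mono s
    ; p∈ = a∈ ∘ (_↑ˡ s) ; q∉ = b∉ ∘ (s ↑ʳ_)
    ; ordered = inj₁ λ i j →
        ≤-<-trans (monotone a-mono (↑ˡ≤last s i)) (<-≤-trans a<b (monotone b-mono (first≤↑ʳ s j)))
    }
  by-medians (tri≈ _ a≡b _) with trans (sym (a∈ last)) (trans (cong A a≡b) (b∉ middle))
  ... | ()
  by-medians (tri> _ _ b<a) = record
    { p = a ∘ (s ↑ʳ_) ; q = b ∘ (_↑ˡ s)
    ; p-mono = a-mono ∘ ↑ʳ-mono s ; q-mono = b-mono ∘ ↑ˡ-mono s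
    ; p∈ = a∈ ∘ (s ↑ʳ_) ; q∉ = b∉ ∘ (_↑ˡ s)
    ; ordered = inj₂ λ i j → <-trans (b-mono (↑ˡ<↑ʳ j (zero {r}))) (<-trans b<a (a-mono (↑ˡ<↑ʳ (fromℕ r) i)))
    }

-- The intervals with ends p i and q j, in one row for each i, cross the cut X. If some row lies
-- in X, two of its intervals share a label but are told apart by a point q j outside X;
-- otherwise each row has an interval outside X, and these tell the points p i apart.
module _ {n G k} (P : PointInterval n G) (X : Fin (V G) → Bool) (ℓ : Fin (V G) → Fin k)
  (cut : ∀ u v w → X u ≡ true → X v ≡ true → X w ≡ false → ℓ u ≡ ℓ v → E G u w ≡ E G v w) where

  private
    X-interval : Fin n → Fin n → Bool
    X-interval a b = X (interval P a b)

  intervals-indistinct : ∀ a b a′ b′ m → X-interval a b ≡ true → X-interval a′ b′ ≡ true →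
    X (point P m) ≡ false → ℓ (interval P a b) ≡ ℓ (interval P a′ b′) → between a b m ≡ between a′ b′ m
  intervals-indistinct a b a′ b′ m ∈₁ ∈₂ ∉ eq = code-injective P
    (trans (sym (incidence P m a b)) (trans (E-sym G _ _)
    (trans (cut _ _ _ ∈₁ ∈₂ ∉ eq)
    (trans (E-sym G _ _) (incidence P m a′ b′)))))

  points-indistinct : ∀ a b m m′ → X (point P m) ≡ true → X (point P m′) ≡ true →
    X-interval a b ≡ false → ℓ (point P m) ≡ ℓ (point P m′) → between a b m ≡ between a b m′
  points-indistinct a b m m′ ∈₁ ∈₂ ∉ eq = code-injective P
    (trans (sym (incidence P m a b)) (trans (cut _ _ _ ∈₁ ∈₂ ∉ eq) (incidence P m′ a b)))

  crossing : ¬ Interleaved (X ∘ point P) (suc k)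
  crossing record { p = p ; q = q ; p-mono = p-mono ; q-mono = q-mono ; p∈ = p∈ ; q∉ = q∉ ; ordered = inj₁ p<q } =
    no-column λ i → row i (any? λ j → X-interval (p i) (q j) Bool.≟ false)
    where
    row : ∀ i → Dec (∃ λ j → X-interval (p i) (q j) ≡ false) → ∃ λ j → X-interval (p i) (q j) ≡ false
    row i (yes found) = found
    row i (no ∄j) with pigeonhole (n<1+n k) (λ j → ℓ (interval P (p i) (q j)))
    ... | j , j′ , j<j′ , eq = contradiction
      (intervals-indistinct (p i) (q j) (p i) (q j′) (q j′) (¬-not λ h → ∄j (j , h)) (¬-not λ h → ∄j (j′ , h)) (q∉ j′) eq)
      -- The point `q j′` ends the second interval and lies beyond the end of the first.
      (≢-sym (differ (between-true _ _ _ (<⇒≤ (p<q i j′)) ≤-refl) (between-above (p i) _ _ (q-mono j<j′))))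

    no-column : ¬ (∀ i → ∃ λ j → X-interval (p i) (q j) ≡ false)
    no-column column with pigeonhole (n<1+n k) (ℓ ∘ point P ∘ p)
    -- The row of the later point is the right one: its intervals start at `p i′` and so miss `p i`.
    ... | i , i′ , i<i′ , eq with column i′
    ...   | j , out = contradiction
      (points-indistinct (p i′) (q j) (p i) (p i′) (p∈ i) (p∈ i′) out eq)
      (≢-sym (differ (between-true _ _ _ ≤-refl (<⇒≤ (p<q i′ j))) (between-below _ _ _ (p-mono i<i′))))
  crossing record { p = p ; q = q ; p-mono = p-mono ; q-mono = q-mono ; p∈ = p∈ ; q∉ = q∉ ; ordered = inj₂ q<p } =
    no-column λ i → row i (any? λ j → X-interval (q j) (p i) Bool.≟ false)
    where
    row : ∀ i → Dec (∃ λ j → X-interval (q j) (p i) ≡ false) → ∃ λ j → X-interval (q j) (p i) ≡ false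
    row i (yes found) = found
    row i (no ∄j) with pigeonhole (n<1+n k) (λ j → ℓ (interval P (q j) (p i)))
    ... | j , j′ , j<j′ , eq = contradiction
      (intervals-indistinct (q j) (p i) (q j′) (p i) (q j) (¬-not λ h → ∄j (j , h)) (¬-not λ h → ∄j (j′ , h)) (q∉ j) eq)
      (differ (between-true _ _ _ ≤-refl (<⇒≤ (q<p i j))) (between-below _ _ _ (q-mono j<j′)))

    no-column : ¬ (∀ i → ∃ λ j → X-interval (q j) (p i) ≡ false)
    no-column column with pigeonhole (n<1+n k) (ℓ ∘ point P ∘ p)
    -- Now the intervals end at the points `p`, so the row of the earlier point separates: it
    -- contains `p i` and misses `p i′`.
    ... | i , i′ , i<i′ , eq with column i
    ...   | j , out = contradiction
      (points-indistinct (q j) (p i) (p i) (p i′) (p∈ i) (p∈ i′) out eq)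
      (differ (between-true _ _ _ (<⇒≤ (q<p i j)) ≤-refl) (between-above (q j) _ _ (p-mono i<i′)))

-- With s = k + 1, a cut holds between 2s and 4s of at least 6s points, which leaves at least 2s
-- outside. Interleaving halves both sets to s points, one more than there are labels.
PointInterval⇒¬CWAtMost : ∀ {n G} k → suc k + suc k + (suc k + suc k) + (suc k + suc k) ≤ n →
  PointInterval n G → ¬ CWAtMost k G
PointInterval⇒¬CWAtMost {n} {G} k large P (e , f , f-injective , f-adj)
  with balanced-cut {t = suc k + suc k} e (just ∘ f ∘ point P)
         (λ p q x p↦ q↦ → point-injective P (f-injective (just-injective (trans p↦ (sym q↦)))))
         (s≤s z≤n)
         (subst (suc k + suc k ≤_) (sym (count-true n)) (≤-trans (m≤n+m (suc k + suc k) (suc k + suc k + (suc k + suc k))) large))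
... | C , lower , upper = crossing P (X C ∘ f) (ℓ C ∘ f)
  (λ u v w u∈ v∈ w∉ eq → trans (f-adj u w) (trans (adj-cut C (f u) (f v) (f w) u∈ v∈ w∉ eq) (sym (f-adj v w))))
  (interleave _ (suc k) lower (+-cancelˡ-≤ (count inside) (suc k + suc k) (count (not ∘ inside))
    (≤-trans (+-monoˡ-≤ (suc k + suc k) upper) (≤-trans large (≤-reflexive (sym (count-not inside)))))))
  where
  inside : Fin n → Bool
  inside = X C ∘ f ∘ point P

-- Weak chordality

true≢false : ∀ {x} → x ≡ true → x ≢ false
true≢false refl ()

∨-trueˡ : ∀ {x y} → x ≡ true → x ∨ y ≡ true
∨-trueˡ refl = refl

does-true : ∀ {A : Set} (a? : Dec A) → does a? ≡ true → A
does-true (yes a) _ = a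

isYes-true : ∀ {A : Set} (a? : Dec A) → A → isYes a? ≡ true
isYes-true a? a = trans (isYes≗does a?) (dec-true a? a)

isYes-false : ∀ {A : Set} (a? : Dec A) → ¬ A → isYes a? ≡ false
isYes-false a? ¬a = trans (isYes≗does a?) (dec-false a? ¬a)

≢⇒≠ᵇ : ∀ {n} {u v : Fin n} → u ≢ v → (u ≠ᵇ v) ≡ true
≢⇒≠ᵇ {u = u} {v} u≢v = cong not (isYes-false (u ≟ v) u≢v)

E-complement : ∀ G {u v} → u ≢ v → E (complement G) u v ≡ not (E G u v)
E-complement G {u} {v} u≢v rewrite E-sym G v u | ≢⇒≠ᵇ u≢v = ∨-idem (not (E G u v))

E-complement² : ∀ G u v → E (complement (complement G)) u v ≡ E G u v
E-complement² G u v = by-cases (u ≟ v)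
  where
  by-cases : Dec (u ≡ v) → E (complement (complement G)) u v ≡ E G u v
  by-cases (yes refl) = trans (E-irr (complement (complement G)) u) (sym (E-irr G u))
  by-cases (no u≢v)   = trans (E-complement (complement G) u≢v)
    (trans (cong not (E-complement G u≢v)) (not-involutive (E G u v)))

⊑-complement² : ∀ {H G} → H ⊑ complement (complement G) → H ⊑ G
⊑-complement² {G = G} (f , f-inj , f-E) = f , f-inj , λ u v → trans (f-E u v) (E-complement² G (f u) (f v))

Bicolouring CoBicolouring SplitColouring : (G : Graph) → (Fin (V G) → Bool) → Set
Bicolouring   G c = ∀ u v → c u ≡ c v → E G u v ≡ false
CoBicolouring G c = ∀ u v → c u ≡ c v → u ≢ v → E G u v ≡ true
SplitColouring G c =
  (∀ {u v} → c u ≡ true → c v ≡ true → u ≢ v → E G u v ≡ true) ×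
  (∀ {u v} → c u ≡ false → c v ≡ false → E G u v ≡ false)

complement-bicolouring : ∀ {G c} → Bicolouring G c → CoBicolouring (complement G) c
complement-bicolouring {G} bip u v eq u≢v = trans (E-complement G u≢v) (cong not (bip u v eq))

-- Complementing exchanges the clique and the independent set, so excluding cycles from split graphs
-- also excludes their complements.
complement-split : ∀ {G c} → SplitColouring G c → SplitColouring (complement G) (not ∘ c)
complement-split {G} {c} (clique , independent) =
  (λ cu cv u≢v → trans (E-complement G u≢v) (cong not (independent (not-injective cu) (not-injective cv)))) ,
  λ {u} {v} cu cv → independent′ u v (not-injective cu) (not-injective cv)
  where
  independent′ : ∀ u v → c u ≡ true → c v ≡ true → E (complement G) u v ≡ false
  independent′ u v cu cv with u ≟ v
  ... | yes refl = refl
  ... | no u≢v rewrite clique cu cv u≢v | clique cv cu (≢-sym u≢v) = refl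

-- Cycles of length at least five

module CycleFacts (q : ℕ) where

  r : ℕ
  r = 5 + q

  -- The vertex at offset `t` from `i`. Adjacency of two such vertices depends only on their
  -- offsets, so the cycle can be inspected around any vertex.
  rot : ℕ → ℕ → Fin r
  rot i t = (i + t) mod r

  toℕ-rot : ∀ i t → toℕ (rot i t) ≡ (i + t) % r
  toℕ-rot i t = toℕ-fromℕ< (m%n<n (i + t) r)

  %-absorbˡ : ∀ x y → (x % r + y) % r ≡ (x + y) % r
  %-absorbˡ x y = trans (%-distribˡ-+ (x % r) y r)
    (trans (cong (λ z → (z + y % r) % r) (m%n%n≡m%n x r)) (sym (%-distribˡ-+ x y r)))

  suc-rot : ∀ i t → suc (toℕ (rot i t)) % r ≡ (i + suc t) % r
  suc-rot i t = trans (cong (λ z → suc z % r) (toℕ-rot i t))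
    (trans (cong (_% r) (+-comm 1 ((i + t) % r)))
    (trans (%-absorbˡ (i + t) 1) (cong (_% r) (trans (+-comm (i + t) 1) (sym (+-suc i t))))))

  -- Adding `r ∸ i` undoes the shift by `i` modulo `r`.
  %-cancelˡ : ∀ i x y → i < r → (i + x) % r ≡ (i + y) % r → x % r ≡ y % r
  %-cancelˡ i x y i<r eq = trans (sym (undo x)) (trans (cong (λ z → (z + (r ∸ i)) % r) eq) (undo y))
    where
    undo : ∀ x → ((i + x) % r + (r ∸ i)) % r ≡ x % r
    undo x = trans (%-absorbˡ (i + x) (r ∸ i)) (trans (cong (_% r) rearrange) ([m+n]%n≡m%n x r))
      where
      rearrange : i + x + (r ∸ i) ≡ x + r
      rearrange = trans (cong (_+ (r ∸ i)) (+-comm i x))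
        (trans (+-assoc x i (r ∸ i)) (cong (x +_) (m+[n∸m]≡n (<⇒≤ i<r))))

  module _ (i : Fin r) where

    edge : ∀ s t → suc s % r ≡ t % r → s % r ≢ t % r → E (Cycle r) (rot (toℕ i) s) (rot (toℕ i) t) ≡ true
    edge s t next s≢t = cong₂ _∧_
      (≢⇒≠ᵇ λ eq → s≢t (%-cancelˡ (toℕ i) s t (toℕ<n i)
        (trans (sym (toℕ-rot (toℕ i) s)) (trans (cong toℕ eq) (toℕ-rot (toℕ i) t)))))
      (∨-trueˡ (isYes-true (_ ℕ.≟ _) (trans (suc-rot (toℕ i) s) (trans (next′ s t next) (sym (toℕ-rot (toℕ i) t))))))
      where
      next′ : ∀ s t → suc s % r ≡ t % r → (toℕ i + suc s) % r ≡ (toℕ i + t) % r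
      next′ s t eq = trans (%-distribˡ-+ (toℕ i) (suc s) r)
        (trans (cong (λ z → (toℕ i % r + z) % r) eq) (sym (%-distribˡ-+ (toℕ i) t r)))

    non-edge : ∀ s t → suc s % r ≢ t % r → suc t % r ≢ s % r → E (Cycle r) (rot (toℕ i) s) (rot (toℕ i) t) ≡ false
    non-edge s t ¬next ¬prev = trans (cong ((rot (toℕ i) s ≠ᵇ rot (toℕ i) t) ∧_)
      (cong₂ _∨_ (isYes-false (_ ℕ.≟ _) (not-next s t ¬next)) (isYes-false (_ ℕ.≟ _) (not-next t s ¬prev)))) (∧-zeroʳ _)
      where
      not-next : ∀ s t → suc s % r ≢ t % r → suc (toℕ (rot (toℕ i) s)) % r ≢ toℕ (rot (toℕ i) t)
      not-next s t ¬next eq = ¬next (%-cancelˡ (toℕ i) (suc s) t (toℕ<n i)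
        (trans (sym (suc-rot (toℕ i) s)) (trans eq (toℕ-rot (toℕ i) t))))

  small : ∀ {x} → x < r → x % r ≡ x
  small = m<n⇒m%n≡m

  3+q<r : 3 + q < r
  3+q<r = s≤s (n≤1+n (3 + q))

  4+q<r : 4 + q < r
  4+q<r = n<1+n (4 + q)

  rot-zero : ∀ i → rot (toℕ i) 0 ≡ i
  rot-zero i = toℕ-injective (trans (toℕ-rot (toℕ i) 0) (trans (cong (_% r) (+-comm (toℕ i) 0)) (small (toℕ<n i))))

  record Surrounding (i : Fin r) : Set where
    field
      a b c d : Fin r
      ab      : E (Cycle r) a b ≡ true
      bi      : E (Cycle r) b i ≡ true
      ic      : E (Cycle r) i c ≡ true
      cd      : E (Cycle r) c d ≡ true
      ac      : E (Cycle r) a c ≡ false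
      bd      : E (Cycle r) b d ≡ false

  surrounding : ∀ i → Surrounding i
  surrounding i = record
    -- Modulo `r = 5 + q` the offsets of `a` and `b` are -2 and -1.
    { a  = rot (toℕ i) (3 + q)
    ; b  = rot (toℕ i) (4 + q)
    ; c  = rot (toℕ i) 1
    ; d  = rot (toℕ i) 2
    ; ab = edge i (3 + q) (4 + q) refl λ eq → contradiction (trans (sym (small 3+q<r)) (trans eq (small 4+q<r))) λ ()
    ; bi = subst (λ z → E (Cycle r) (rot (toℕ i) (4 + q)) z ≡ true) (rot-zero i)
             (edge i (4 + q) 0 (n%n≡0 r) λ eq → contradiction (trans (sym (small 4+q<r)) eq) λ ())
    ; ic = subst (λ z → E (Cycle r) z (rot (toℕ i) 1) ≡ true) (rot-zero i) (edge i 0 1 refl λ ())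
    ; cd = edge i 1 2 refl λ ()
    ; ac = non-edge i (3 + q) 1
             (λ eq → contradiction (trans (sym (small 4+q<r)) eq) λ ())
             (λ eq → contradiction (trans eq (small 3+q<r)) λ ())
    ; bd = non-edge i (4 + q) 2
             (λ eq → contradiction (trans (sym (n%n≡0 r)) eq) λ ())
             (λ eq → contradiction (trans eq (small 4+q<r)) λ ())
    }

-- The case distinction lets the remainder compute: the successor of vertex 4 wraps round to 0 only
-- in the 5-cycle.
cycle-14 : ∀ q → E (Cycle (5 + q)) 1F 4F ≡ false
cycle-14 zero    = refl
cycle-14 (suc _) = refl

cycle-24 : ∀ q → E (Cycle (5 + q)) 2F 4F ≡ false
cycle-24 zero    = refl
cycle-24 (suc _) = refl

-- If vertex 0 is in the clique, its non-neighbours 2 and 3 are both independent, yet adjacent.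
-- Otherwise its neighbour 1 is in the clique, and 3 and 4 give the same contradiction.
split⇒Cycle-free : ∀ {G c} q → SplitColouring G c → Free (Cycle (5 + q)) G
split⇒Cycle-free {G} {c} q (clique , independent) (f , f-inj , f-E) = by-colour (c (f 0F)) refl
  where
  far : ∀ {i j} → i ≢ j → E (Cycle (5 + q)) i j ≡ false → c (f i) ≡ true → c (f j) ≡ false
  far {i} {j} i≢j non-edge ci = ¬-not λ cj →
    true≢false (trans (f-E i j) (clique ci cj (i≢j ∘ f-inj))) non-edge

  near : ∀ {i j} → E (Cycle (5 + q)) i j ≡ true → c (f i) ≡ false → c (f j) ≡ true
  near {i} {j} edge ci = ¬-not λ cj → true≢false edge (trans (f-E i j) (independent ci cj))

  by-colour : ∀ x → c (f 0F) ≡ x → ⊥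
  by-colour true  c₀ =
    true≢false (near {2F} {3F} refl (far {0F} {2F} (λ ()) refl c₀)) (far {0F} {3F} (λ ()) refl c₀)
  by-colour false c₀ =
    true≢false (near {3F} {4F} refl (far {1F} {3F} (λ ()) refl c₁)) (far {1F} {4F} (λ ()) (cycle-14 q) c₁)
    where
    c₁ : c (f 1F) ≡ true
    c₁ = near {0F} {1F} refl c₀

-- 0, 2, 4, 1, 3 is a closed walk of odd length in the complement of the cycle.
coBicolouring⇒Cycle-free : ∀ {G c} q → CoBicolouring G c → Free (Cycle (5 + q)) G
coBicolouring⇒Cycle-free {G} {c} q cobip (f , f-inj , f-E) =
  not-¬ (trans (two-steps {0F} {2F} {4F} (λ ()) (λ ()) refl (cycle-24 q))
               (two-steps {4F} {1F} {3F} (λ ()) (λ ()) (trans (E-sym (Cycle (5 + q)) 4F 1F) (cycle-14 q)) refl))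
    (one-step {0F} {3F} (λ ()) refl)
  where
  one-step : ∀ {i j} → i ≢ j → E (Cycle (5 + q)) i j ≡ false → c (f i) ≡ not (c (f j))
  one-step {i} {j} i≢j non-edge = ¬-not λ eq →
    true≢false (trans (f-E i j) (cobip (f i) (f j) eq (i≢j ∘ f-inj))) non-edge

  two-steps : ∀ {i j k} → i ≢ j → j ≢ k → E (Cycle (5 + q)) i j ≡ false → E (Cycle (5 + q)) j k ≡ false →
    c (f i) ≡ c (f k)
  two-steps {i} {j} {k} i≢j j≢k ij jk =
    trans (one-step i≢j ij) (trans (cong not (one-step j≢k jk)) (not-involutive (c (f k))))

argmin : ∀ {n} (ρ : Fin (suc n) → ℕ) → ∃ λ i → ∀ j → ρ i ≤ ρ j
argmin {zero}  ρ = 0F , λ { 0F → ≤-refl }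
argmin {suc n} ρ with argmin (ρ ∘ suc)
... | i , i-min with ≤-total (ρ 0F) (ρ (suc i))
...   | inj₁ ρ0≤ = 0F , λ { 0F → ≤-refl ; (suc j) → ≤-trans ρ0≤ (i-min j) }
...   | inj₂ ≤ρ0 = suc i , λ { 0F → ≤ρ0 ; (suc j) → i-min j }

-- The adjacency matrix, with rows and columns ordered by rank, has no submatrix Γ = [1 1; 1 0].
ΓFree : ∀ G → (Fin (V G) → ℕ) → Set
ΓFree G rank = ∀ {x x′ y y′} → rank x ≤ rank x′ → rank y ≤ rank y′ →
  E G x y ≡ true → E G x y′ ≡ true → E G x′ y ≡ true → E G x′ y′ ≡ true

-- Let i have the least rank on the cycle, and let the path a b i c d surround it. If b ranks
-- below c, then Γ-freeness applied to i, a and b, c makes a and c adjacent.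
ΓFree⇒Cycle-free : ∀ {G rank} q → ΓFree G rank → Free (Cycle (5 + q)) G
ΓFree⇒Cycle-free {G} {rank} q γ (f , f-inj , f-E) = by-rank (≤-total (rank (f b)) (rank (f c)))
  where
  i : Fin (5 + q)
  i = proj₁ (argmin (rank ∘ f))

  i-min : ∀ j → rank (f i) ≤ rank (f j)
  i-min = proj₂ (argmin (rank ∘ f))

  open CycleFacts.Surrounding (CycleFacts.surrounding q i)

  along : ∀ {u v} → E (Cycle (5 + q)) u v ≡ true → E G (f u) (f v) ≡ true
  along {u} {v} = trans (sym (f-E u v))

  against : ∀ {u v} → E (Cycle (5 + q)) u v ≡ true → E G (f v) (f u) ≡ true
  against {u} {v} uv = trans (E-sym G (f v) (f u)) (along uv)

  by-rank : rank (f b) ≤ rank (f c) ⊎ rank (f c) ≤ rank (f b) → ⊥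
  by-rank (inj₁ b≤c) =
    true≢false (trans (f-E a c) (γ (i-min a) b≤c (against bi) (along ic) (along ab))) ac
  by-rank (inj₂ c≤b) =
    true≢false (trans (f-E b d) (trans (E-sym G (f b) (f d))
      (γ (i-min d) c≤b (along ic) (against bi) (against cd)))) bd

5≤⇒5+ : ∀ {P : ℕ → Set} → (∀ q → P (5 + q)) → ∀ r → 5 ≤ r → P r
5≤⇒5+ P5+ _ (s≤s (s≤s (s≤s (s≤s (s≤s (z≤n {q})))))) = P5+ q

split⇒WeaklyChordal : ∀ {G c} → SplitColouring G c → WeaklyChordal G
split⇒WeaklyChordal {G} {c} split = 5≤⇒5+ λ q →
  split⇒Cycle-free {G} {c} q split , split⇒Cycle-free {complement G} {not ∘ c} q (complement-split {G} split)

bipartite-ΓFree⇒WeaklyChordal : ∀ {G c rank} → Bicolouring G c → ΓFree G rank → WeaklyChordal G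
bipartite-ΓFree⇒WeaklyChordal {G} {c} {rank} bip γ = 5≤⇒5+ λ q →
  ΓFree⇒Cycle-free {G} {rank} q γ , coBicolouring⇒Cycle-free {complement G} {c} q (complement-bicolouring {G} bip)

complement-WeaklyChordal : ∀ {G} → WeaklyChordal G → WeaklyChordal (complement G)
complement-WeaklyChordal {G} wc r 5≤r =
  proj₂ (wc r 5≤r) , proj₁ (wc r 5≤r) ∘ ⊑-complement² {Cycle r} {G}

-- The incidence graph of points and intervals

Cell : ℕ → Set
Cell n = Fin n ⊎ (Fin n × Fin n)

decode : ∀ n → Fin (n + n * n) → Cell n
decode n = Sum.map₂ (remQuot n) ∘ splitAt n

-- mkGraph symmetrises, so each point-interval pair is listed in one direction only.
incident : ∀ {n} → Bool → Cell n → Cell n → Bool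
incident κ (inj₁ p) (inj₁ q)       = κ
incident κ (inj₁ p) (inj₂ (a , b)) = between a b p
incident κ (inj₂ _) _              = false

-- The flag `κ` makes the points a clique: false gives the bipartite graph, true the split graph.
-- Pairs with `b` before `a` count as empty intervals.
Convex : Bool → ℕ → Graph
Convex κ n = mkGraph (n + n * n) (λ u v → incident κ (decode n u) (decode n v))

module _ (n : ℕ) where

  pointOf : Fin n → Fin (n + n * n)
  pointOf p = p ↑ˡ (n * n)

  intervalOf : Fin n → Fin n → Fin (n + n * n)
  intervalOf a b = n ↑ʳ combine a b

  decode-point : ∀ p → decode n (pointOf p) ≡ inj₁ p
  decode-point p rewrite splitAt-↑ˡ n p (n * n) = refl

  decode-interval : ∀ a b → decode n (intervalOf a b) ≡ inj₂ (a , b)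
  decode-interval a b rewrite splitAt-↑ʳ n (n * n) (combine a b) = cong inj₂ (remQuot-combine a b)

  point≢interval : ∀ p a b → pointOf p ≢ intervalOf a b
  point≢interval p a b eq with trans (sym (decode-point p)) (trans (cong (decode n) eq) (decode-interval a b))
  ... | ()

  Convex-PointInterval : ∀ κ → PointInterval n (Convex κ n)
  Convex-PointInterval κ = record
    { point           = pointOf
    ; interval        = intervalOf
    ; point-injective = λ {p} {q} → ↑ˡ-injective (n * n) p q
    ; disjoint        = point≢interval
    ; code            = id
    ; code-injective  = id
    ; incidence       = incidence′
    }
    where
    incidence′ : ∀ p a b → E (Convex κ n) (pointOf p) (intervalOf a b) ≡ between a b p
    incidence′ p a b rewrite ≢⇒≠ᵇ (point≢interval p a b) | decode-point p | decode-interval a b = ∨-identityʳ _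

PointInterval-complement : ∀ {n G} → PointInterval n G → PointInterval n (complement G)
PointInterval-complement {G = G} P = record
  { point           = point P
  ; interval        = interval P
  ; point-injective = point-injective P
  ; disjoint        = disjoint P
  ; code            = not ∘ code P
  ; code-injective  = code-injective P ∘ not-injective
  ; incidence       = λ p a b → trans (E-complement G (disjoint P p a b)) (cong not (incidence P p a b))
  }

isPoint : ∀ {n} → Cell n → Bool
isPoint (inj₁ _) = true
isPoint (inj₂ _) = false

Convex-bicolouring : ∀ n → Bicolouring (Convex false n) (isPoint ∘ decode n)
Convex-bicolouring n u v eq = trans (cong ((u ≠ᵇ v) ∧_) (monochromatic (decode n u) (decode n v) eq)) (∧-zeroʳ _)
  where
  monochromatic : ∀ x y → isPoint x ≡ isPoint y → incident false x y ∨ incident false y x ≡ false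
  monochromatic (inj₁ _) (inj₁ _) _ = refl
  monochromatic (inj₂ _) (inj₂ _) _ = refl

Convex-split : ∀ n → SplitColouring (Convex true n) (isPoint ∘ decode n)
Convex-split n = (λ {u} {v} cu cv u≢v → cong₂ _∧_ (≢⇒≠ᵇ u≢v) (points (decode n u) (decode n v) cu cv)) ,
  (λ {u} {v} cu cv → trans (cong ((u ≠ᵇ v) ∧_) (intervals (decode n u) (decode n v) cu cv)) (∧-zeroʳ _))
  where
  points : ∀ x y → isPoint x ≡ true → isPoint y ≡ true → incident true x y ∨ incident true y x ≡ true
  points (inj₁ _) (inj₁ _) _ _ = refl
  intervals : ∀ x y → isPoint x ≡ false → isPoint y ≡ false → incident true x y ∨ incident true y x ≡ false
  intervals (inj₂ _) (inj₂ _) _ _ = refl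

data _∼_ {n} : Cell n → Cell n → Set where
  contained : ∀ {p a b} → a ≤ᶠ p → p ≤ᶠ b → inj₁ p ∼ inj₂ (a , b)
  contains  : ∀ {p a b} → a ≤ᶠ p → p ≤ᶠ b → inj₂ (a , b) ∼ inj₁ p

between⁻ : ∀ {n} (a b p : Fin n) → between a b p ≡ true → a ≤ᶠ p × p ≤ᶠ b
between⁻ a b p eq =
  does-true (a ≤ᶠ? p) (∧-conicalˡ _ _ eq) , does-true (p ≤ᶠ? b) (∧-conicalʳ (does (a ≤ᶠ? p)) _ eq)

module _ (n : ℕ) where

  rank : Cell n → ℕ
  rank (inj₁ p)       = toℕ p
  rank (inj₂ (_ , b)) = toℕ b

  -- Since intervals are ranked by their right ends, both cases come down to the chain a′ ≤ p ≤ p′ ≤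
  -- b ≤ b′.
  ∼-ΓFree : ∀ {x x′ y y′} → rank x ≤ rank x′ → rank y ≤ rank y′ → x ∼ y → x ∼ y′ → x′ ∼ y → x′ ∼ y′
  ∼-ΓFree p≤p′ b≤b′ (contained _ _) (contained a′≤p _) (contained _ p′≤b) =
    contained (≤-trans a′≤p p≤p′) (≤-trans p′≤b b≤b′)
  ∼-ΓFree b≤b′ p≤p′ (contains _ _) (contains _ p′≤b) (contains a′≤p _) =
    contains (≤-trans a′≤p p≤p′) (≤-trans p′≤b b≤b′)

  edge⇒∼ : ∀ {u v} → E (Convex false n) u v ≡ true → decode n u ∼ decode n v
  edge⇒∼ {u} {v} eq = incident⇒∼ (decode n u) (decode n v) (∧-conicalʳ (u ≠ᵇ v) _ eq)
    where
    incident⇒∼ : ∀ x y → incident false x y ∨ incident false y x ≡ true → x ∼ y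
    incident⇒∼ (inj₁ p) (inj₂ (a , b)) eq with between⁻ a b p (trans (sym (∨-identityʳ _)) eq)
    ... | a≤p , p≤b = contained a≤p p≤b
    incident⇒∼ (inj₂ (a , b)) (inj₁ p) eq with between⁻ a b p eq
    ... | a≤p , p≤b = contains a≤p p≤b

  ∼⇒edge : ∀ {u v} → decode n u ∼ decode n v → E (Convex false n) u v ≡ true
  ∼⇒edge {u} {v} u∼v = cong₂ _∧_ (≢⇒≠ᵇ {u = u} {v} λ { refl → ∼-irreflexive u∼v }) (∼⇒incident u∼v)
    where
    ∼-irreflexive : ∀ {x} → ¬ (x ∼ x)
    ∼-irreflexive ()
    ∼⇒incident : ∀ {x y} → x ∼ y → incident false x y ∨ incident false y x ≡ true
    ∼⇒incident (contained {p} {a} {b} a≤p p≤b) = cong (_∨ false) (between-true a b p a≤p p≤b)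
    ∼⇒incident (contains  {p} {a} {b} a≤p p≤b) = between-true a b p a≤p p≤b

  Convex-ΓFree : ΓFree (Convex false n) (rank ∘ decode n)
  Convex-ΓFree x≤x′ y≤y′ xy xy′ x′y = ∼⇒edge (∼-ΓFree x≤x′ y≤y′ (edge⇒∼ xy) (edge⇒∼ xy′) (edge⇒∼ x′y))

Convex-WeaklyChordal : ∀ n → WeaklyChordal (Convex false n)
Convex-WeaklyChordal n = bipartite-ΓFree⇒WeaklyChordal {Convex false n} {rank = rank n ∘ decode n} (Convex-bicolouring n) (Convex-ΓFree n)

-- Decidability of induced containment

any-function? : ∀ {m n} {P : (Fin m → Fin n) → Set} → (∀ {f g} → f ≗ g → P f → P g) →
  (∀ f → Dec (P f)) → Dec (∃ P)
any-function? {zero} resp P? =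
  -- Functions out of `Fin 0` are only pointwise equal, hence the demand that `P` respect `≗`.
  map′ (λ p → _ , p) (λ (f , p) → resp (λ ()) p) (P? λ ())
any-function? {suc m} {n} {P} resp P? =
  map′ (λ (x , f , p) → x ∷ f , p)
       (λ (f , p) → f 0F , f ∘ suc , resp (λ { 0F → refl ; (suc _) → refl }) p)
       (any? λ x → any-function? {P = λ f → P (x ∷ f)}
         (λ f≗g → resp λ { 0F → refl ; (suc i) → f≗g i }) (λ f → P? (x ∷ f)))

-- Decidability makes `H ⊑ P4` stable under double negation, so it can be proved by contradiction.
_⊑?_ : ∀ H G → Dec (H ⊑ G)
H ⊑? G = map′
  (λ (f , f-inj , f-E) → f , (λ {u} {v} → f-inj u v) , f-E)
  (λ (f , f-inj , f-E) → f , (λ u v → f-inj) , f-E)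
  (any-function? {P = Embeds} embeds-cong
    λ f → (all? λ u → all? λ v → (f u ≟ f v) →-dec (u ≟ v)) ×-dec
          (all? λ u → all? λ v → E H u v Bool.≟ E G (f u) (f v)))
  where
  Embeds : (Fin (V H) → Fin (V G)) → Set
  Embeds f = (∀ u v → f u ≡ f v → u ≡ v) × (∀ u v → E H u v ≡ E G (f u) (f v))

  embeds-cong : ∀ {f g} → f ≗ g → Embeds f → Embeds g
  embeds-cong f≗g (inj , pres) =
    (λ u v eq → inj u v (trans (f≗g u) (trans eq (sym (f≗g v))))) ,
    (λ u v → trans (pres u v) (cong₂ (E G) (f≗g u) (f≗g v)))

-- Graphs that are bipartite, co-bipartite and split

⊑-bicolouring : ∀ {H G c} → Bicolouring G c → ((f , _) : H ⊑ G) → Bicolouring H (c ∘ f)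
⊑-bicolouring bip (f , _ , f-E) u v eq = trans (f-E u v) (bip (f u) (f v) eq)

⊑-coBicolouring : ∀ {H G c} → CoBicolouring G c → ((f , _) : H ⊑ G) → CoBicolouring H (c ∘ f)
⊑-coBicolouring cobip (f , f-inj , f-E) u v eq u≢v = trans (f-E u v) (cobip (f u) (f v) eq (u≢v ∘ f-inj))

⊑-split : ∀ {H G c} → SplitColouring G c → ((f , _) : H ⊑ G) → SplitColouring H (c ∘ f)
⊑-split (clique , independent) (f , f-inj , f-E) =
  (λ {u} {v} cu cv u≢v → trans (f-E u v) (clique cu cv (u≢v ∘ f-inj))) ,
  (λ {u} {v} cu cv → trans (f-E u v) (independent cu cv))

-- Each of the two edges has an end in the clique, and these two ends would be adjacent.
split⇒2P2-free : ∀ {G c} → SplitColouring G c → ∀ {x y z w} → x ≢ z → x ≢ w → y ≢ z → y ≢ w →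
  E G x y ≡ true → E G z w ≡ true →
  E G x z ≡ false → E G x w ≡ false → E G y z ≡ false → E G y w ≡ false → ⊥
split⇒2P2-free {G} {c} (clique , independent) {x} {y} {z} {w} x≢z x≢w y≢z y≢w xy zw xz xw yz yw
  with c x in cx | c y in cy | c z in cz | c w in cw
... | false | false | _     | _     = true≢false xy (independent cx cy)
... | _     | _     | false | false = true≢false zw (independent cz cw)
... | true  | _     | true  | _     = true≢false (clique cx cz x≢z) xz
... | true  | _     | false | true  = true≢false (clique cx cw x≢w) xw
... | false | true  | true  | _     = true≢false (clique cy cz y≢z) yz
... | false | true  | false | true  = true≢false (clique cy cw y≢w) yw

-- Each diagonal has an end in the independent set, and ends of different diagonals are adjacent.
split⇒C4-free : ∀ {G c} → SplitColouring G c → ∀ {x y z w} → x ≢ z → y ≢ w →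
  E G x y ≡ true → E G y z ≡ true → E G z w ≡ true → E G w x ≡ true →
  E G x z ≡ false → E G y w ≡ false → ⊥
split⇒C4-free {G} {c} (clique , independent) {x} {y} {z} {w} x≢z y≢w xy yz zw wx xz yw
  with c x in cx | c y in cy | c z in cz | c w in cw
... | true  | _     | true  | _     = true≢false (clique cx cz x≢z) xz
... | _     | true  | _     | true  = true≢false (clique cy cw y≢w) yw
... | false | false | _     | _     = true≢false xy (independent cx cy)
... | _     | false | false | _     = true≢false yz (independent cy cz)
... | false | true  | _     | false = true≢false wx (independent cw cx)
... | true  | true  | false | false = true≢false zw (independent cz cw)

-- The vertices of P4, numbered by their colours under a bicolouring and a co-bicolouring.
place : Bool → Bool → Fin 4
place true  false = 0F
place false false = 1F
place true  true  = 2F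
place false true  = 3F

place⁻ : Fin 4 → Bool × Bool
place⁻ 0F = true  , false
place⁻ 1F = false , false
place⁻ 2F = true  , true
place⁻ 3F = false , true

place⁻-place : ∀ x y → place⁻ (place x y) ≡ (x , y)
place⁻-place true  false = refl
place⁻-place false false = refl
place⁻-place true  true  = refl
place⁻-place false true  = refl

module _ {H c₁ c₂} (bip : Bicolouring H c₁) (cobip : CoBicolouring H c₂) where

  colours-injective : ∀ {u v} → c₁ u ≡ c₁ v → c₂ u ≡ c₂ v → u ≡ v
  colours-injective {u} {v} eq₁ eq₂ =
    decidable-stable (u ≟ v) λ u≢v → true≢false (cobip u v eq₂ u≢v) (bip u v eq₁)

  -- The colourings decide every pair except those differing in both colours. The two hypotheses
  -- settle these as the middle edge and the pair of ends of P4.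
  ⊑P4 : (∀ {u v} → c₁ u ≡ false → c₂ u ≡ false → c₁ v ≡ true → c₂ v ≡ true → E H u v ≡ true) →
        (∀ {u v} → c₁ u ≡ false → c₂ u ≡ true → c₁ v ≡ true → c₂ v ≡ false → E H u v ≡ false) →
        H ⊑ P4
  ⊑P4 middle ends = f , f-injective , f-E
    where
    f : Fin (V H) → Fin 4
    f u = place (c₁ u) (c₂ u)

    f-injective : ∀ {u v} → f u ≡ f v → u ≡ v
    f-injective {u} {v} eq = colours-injective (cong proj₁ eq′) (cong proj₂ eq′)
      where
      eq′ : (c₁ u , c₂ u) ≡ (c₁ v , c₂ v)
      eq′ = trans (sym (place⁻-place (c₁ u) (c₂ u))) (trans (cong place⁻ eq) (place⁻-place (c₁ v) (c₂ v)))

    f-E : ∀ u v → E H u v ≡ E P4 (f u) (f v)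
    f-E u v with c₁ u in a | c₂ u in b | c₁ v in c | c₂ v in d
    ... | false | false | false | false = bip u v (trans a (sym c))
    ... | false | false | false | true  = bip u v (trans a (sym c))
    ... | false | true  | false | false = bip u v (trans a (sym c))
    ... | false | true  | false | true  = bip u v (trans a (sym c))
    ... | true  | false | true  | false = bip u v (trans a (sym c))
    ... | true  | false | true  | true  = bip u v (trans a (sym c))
    ... | true  | true  | true  | false = bip u v (trans a (sym c))
    ... | true  | true  | true  | true  = bip u v (trans a (sym c))
    ... | false | false | true  | false = cobip u v (trans b (sym d)) λ u≡v → true≢false c (trans (cong c₁ (sym u≡v)) a)
    ... | false | true  | true  | true  = cobip u v (trans b (sym d)) λ u≡v → true≢false c (trans (cong c₁ (sym u≡v)) a)
    ... | true  | false | false | false = cobip u v (trans b (sym d)) λ u≡v → true≢false a (trans (cong c₁ u≡v) c)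
    ... | true  | true  | false | true  = cobip u v (trans b (sym d)) λ u≡v → true≢false a (trans (cong c₁ u≡v) c)
    ... | false | false | true  | true  = middle a b c d
    ... | true  | true  | false | false = trans (E-sym H u v) (middle c d a b)
    ... | false | true  | true  | false = ends a b c d
    ... | true  | false | false | true  = trans (E-sym H u v) (ends c d a b)

-- H has at most one vertex of each pair of colours. Vertices sharing exactly one colour are
-- adjacent or not as in P4; if neither numbering of P4 fits the other two pairs, then all four
-- vertices are present and induce 2P2 or C4.
three-colourings⇒⊑P4 : ∀ {H c₁ c₂ c₃} → Bicolouring H c₁ → CoBicolouring H c₂ → SplitColouring H c₃ → H ⊑ P4
three-colourings⇒⊑P4 {H} {c₁} {c₂} {c₃} bip cobip split = decidable-stable (H ⊑? P4) λ ¬H⊑P4 →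
  ¬H⊑P4 (⊑P4 {H} {c₁} {c₂} bip cobip
    (λ {u} {v} a b c d → decidable-stable (E H u v Bool.≟ true) λ ¬uv → ¬H⊑P4 (flipped-2P2 u v a b c d (¬-not ¬uv)))
    (λ {u} {v} a b c d → decidable-stable (E H u v Bool.≟ false) λ uv → ¬H⊑P4 (flipped-C4 u v a b c d (¬-not uv))))
  where
  -- Negating `c₁` gives the other numbering of P4, in which the middle pair and the end pair
  -- exchange roles.
  flipped-bip : Bicolouring H (not ∘ c₁)
  flipped-bip u v eq = bip u v (not-injective eq)

  unique : ∀ {u v x y} → c₁ u ≡ x → c₂ u ≡ y → c₁ v ≡ x → c₂ v ≡ y → u ≡ v
  unique a b c d = colours-injective {H} {c₁} {c₂} bip cobip (trans a (sym c)) (trans b (sym d))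

  apart : ∀ {u v} → c₂ u ≡ false → c₂ v ≡ true → u ≢ v
  apart b d refl = true≢false d b

  swap : ∀ {u v x} → E H u v ≡ x → E H v u ≡ x
  swap {u} {v} = trans (E-sym H v u)

  same₂ : ∀ {u v y} → c₁ u ≡ false → c₂ u ≡ y → c₁ v ≡ true → c₂ v ≡ y → E H u v ≡ true
  same₂ {u} {v} a b c d = cobip u v (trans b (sym d)) λ { refl → true≢false c a }

  same₁ : ∀ {u v x} → c₁ u ≡ x → c₁ v ≡ x → E H u v ≡ false
  same₁ {u} {v} a c = bip u v (trans a (sym c))

  flipped-2P2 : ∀ u v → c₁ u ≡ false → c₂ u ≡ false → c₁ v ≡ true → c₂ v ≡ true → E H u v ≡ false → H ⊑ P4
  flipped-2P2 u v a b c d uv = ⊑P4 {H} {not ∘ c₁} {c₂} flipped-bip cobip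
    (λ {u′} {v′} a′ b′ c′ d′ → ¬-not λ u′v′ →
      split⇒2P2-free {H} {c₃} split (apart b d) (apart b d′) (apart b′ d) (apart b′ d′)
        (same₂ a b (not-injective a′) b′) (swap (same₂ (not-injective c′) d′ c d))
        uv (same₁ a (not-injective c′)) (same₁ (not-injective a′) c) u′v′)
    -- By uniqueness the new end pair is `v`, `u` again, a non-edge by assumption.
    (λ {u′} {v′} a′ b′ c′ d′ → subst₂ (λ s t → E H s t ≡ false)
      (unique c d (not-injective a′) b′) (unique a b (not-injective c′) d′) (swap uv))

  flipped-C4 : ∀ u v → c₁ u ≡ false → c₂ u ≡ true → c₁ v ≡ true → c₂ v ≡ false → E H u v ≡ true → H ⊑ P4
  flipped-C4 u v a b c d uv = ⊑P4 {H} {not ∘ c₁} {c₂} flipped-bip cobip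
    (λ {u′} {v′} a′ b′ c′ d′ → subst₂ (λ s t → E H s t ≡ true)
      (unique c d (not-injective a′) b′) (unique a b (not-injective c′) d′) (swap uv))
    (λ {u′} {v′} a′ b′ c′ d′ → ¬-not λ u′v′ →
      split⇒C4-free {H} {c₃} split (≢-sym (apart d′ b)) (apart d b′)
        uv (swap (same₂ (not-injective c′) d′ c d)) (swap u′v′) (swap (same₂ a b (not-injective a′) b′))
        (same₁ a (not-injective c′)) (same₁ c (not-injective a′)))

-- The equivalence

⊑-trans : ∀ {F G H} → F ⊑ G → G ⊑ H → F ⊑ H
⊑-trans (f , f-inj , f-E) (g , g-inj , g-E) =
  g ∘ f , f-inj ∘ g-inj , λ u v → trans (f-E u v) (g-E (f u) (f v))

theorem2 : (H : Graph) →
    BoundedCW (λ G → Free H G × WeaklyChordal G) ⇔ (H ⊑ P4)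
theorem2 H = mk⇔ bounded⇒⊑P4 ⊑P4⇒bounded
  where
  ⊑P4⇒bounded : H ⊑ P4 → BoundedCW (λ G → Free H G × WeaklyChordal G)
  ⊑P4⇒bounded H⊑P4 = 2 , λ G (H-free , _) → P4-free⇒CWAtMost-2 G (H-free ∘ ⊑-trans {H} {P4} {G} H⊑P4)

  bounded⇒⊑P4 : BoundedCW (λ G → Free H G × WeaklyChordal G) → H ⊑ P4
  bounded⇒⊑P4 (k , bound) = decidable-stable (H ⊑? P4) λ ¬H⊑P4 →
    unavoidable (Convex-PointInterval n false) (Convex-WeaklyChordal n) λ H⊑bipartite →
    unavoidable (PointInterval-complement (Convex-PointInterval n false))
      (complement-WeaklyChordal {Convex false n} (Convex-WeaklyChordal n)) λ H⊑cobipartite →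
    unavoidable (Convex-PointInterval n true) (split⇒WeaklyChordal {Convex true n} (Convex-split n)) λ H⊑split →
    ¬H⊑P4 (three-colourings⇒⊑P4 {H} {c₃ = isPoint ∘ decode n ∘ proj₁ H⊑split}
      (⊑-bicolouring {H} {Convex false n} (Convex-bicolouring n) H⊑bipartite)
      (⊑-coBicolouring {H} {complement (Convex false n)} (complement-bicolouring {Convex false n} (Convex-bicolouring n)) H⊑cobipartite)
      (⊑-split {H} {Convex true n} (Convex-split n) H⊑split))
    where
    n : ℕ
    -- The least number of points that `PointInterval⇒¬CWAtMost` accepts for `k` labels.
    n = suc k + suc k + (suc k + suc k) + (suc k + suc k)

    -- If `G` were `H`-free, the assumed bound would give it clique-width at most `k`. The double
    -- negation suffices, as the embeddings are only used to derive a contradiction.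
    unavoidable : ∀ {G} → PointInterval n G → WeaklyChordal G → ¬ ¬ (H ⊑ G)
    unavoidable {G} P wc H-free = PointInterval⇒¬CWAtMost k ≤-refl P (bound G (H-free , wc))
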